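{- For any tree $T$ and $c>0$, there exists $C>1$ such that the following holds. Given a $(c,t)$-sparse graph $\Gamma$ on $n$ vertices, for some $t$, every subgraph $G\subseteq\Gamma$ with at least $Ctn$ edges contains a copy of $T$ which is an induced subgraph of $\Gamma$.
   Context: A graph $\Gamma$ is $(c,t)$-sparse if for every pair of (not necessarily disjoint) vertex subsets $A,B\subseteq V(\Gamma)$ with $|A|,|B|\ge t$ we have $e(A,B)\le (1-c)|A||B|$, where $e(A,B)$ is the number of ordered pairs $(a,b)\in A\times B$ such that $\{a,b\}$ is an edge of $\Gamma$. -}

module Defs where

open import Data.Fin.Base using (Fin; zero; suc; inject₁; fromℕ; _<_)
open import Data.Fin.Properties using (_<?_)
open import Data.Fin.Subset using (Subset; _∈_; ∣_∣)
open import Data.Fin.Subset.Properties using (_∈?_)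
open import Data.Integer.Base using (+_)
open import Data.List.Base using (allFin; cartesianProduct; filter; length)
open import Data.Nat.Base as ℕ using (ℕ; NonZero)
open import Data.Product.Base using (Σ; _×_; _,_; proj₁; proj₂)
open import Data.Rational.Base using (ℚ; 1ℚ; _-_; _*_; _≤_; _/_)
open import Function.Definitions using (Injective)
open import Level using (0ℓ)
open import Relation.Binary.Construct.Closure.ReflexiveTransitive using (Star)
open import Relation.Binary.Core using (Rel)
open import Relation.Binary.Definitions using (Decidable; Symmetric; Irreflexive)
open import Relation.Binary.PropositionalEquality.Core using (_≡_)
open import Relation.Nullary.Decidable.Core using (_×-dec_)
open import Relation.Nullary.Negation.Core using (¬_)

ℕ→ℚ : ℕ → ℚ
ℕ→ℚ m = + m / 1

-- Finite simple graphs. Decidable adjacency is what allows edges to be counted.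
record Graph (n : ℕ) : Set₁ where
  field
    _~_    : Rel (Fin n) 0ℓ
    _~?_   : Decidable _~_
    sym    : Symmetric _~_
    irrefl : Irreflexive _≡_ _~_

-- The number of elements of A × B (ordered pairs) that are edges; A and B may
-- overlap, and an edge inside A ∩ B is then counted twice.
e : ∀ {n} → Graph n → Subset n → Subset n → ℕ
e {n} Γ A B =
  length (filter (λ p → (proj₁ p ∈? A) ×-dec ((proj₂ p ∈? B) ×-dec (proj₁ p ~? proj₂ p)))
                 (cartesianProduct (allFin n) (allFin n)))
  where open Graph Γ

Sparse : ∀ {n} → ℚ → ℚ → Graph n → Set
Sparse {n} c t Γ = (A B : Subset n) → t ≤ ℕ→ℚ ∣ A ∣ → t ≤ ℕ→ℚ ∣ B ∣ →
  ℕ→ℚ (e Γ A B) ≤ (1ℚ - c) * (ℕ→ℚ ∣ A ∣ * ℕ→ℚ ∣ B ∣)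

-- Subgraphs need be neither spanning nor induced.
record Subgraph {n : ℕ} (Γ : Graph n) : Set₁ where
  field
    verts  : Subset n
    _~_    : Rel (Fin n) 0ℓ
    _~?_   : Decidable _~_
    sym    : Symmetric _~_
    ~⇒∈    : ∀ {u v} → u ~ v → u ∈ verts
    ~⇒Γ~   : ∀ {u v} → u ~ v → Graph._~_ Γ u v

-- Each (unordered) edge is counted once, with its smaller endpoint first.
edgeCount : ∀ {n} {Γ : Graph n} → Subgraph Γ → ℕ
edgeCount {n} G =
  length (filter (λ p → (proj₁ p <? proj₂ p) ×-dec (proj₁ p ~? proj₂ p))
                 (cartesianProduct (allFin n) (allFin n)))
  where open Subgraph G

Connected : ∀ {n} → Graph n → Set
Connected {n} Γ = NonZero n × (∀ u v → Star (Graph._~_ Γ) u v)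

-- A cycle of length 3 + m.
record Cycle {n : ℕ} (Γ : Graph n) : Set where
  open Graph Γ
  field
    m         : ℕ
    vertex    : Fin (3 ℕ.+ m) → Fin n
    injective : Injective _≡_ _≡_ vertex
    step      : ∀ i → vertex (inject₁ i) ~ vertex (suc i)
    close     : vertex (fromℕ (2 ℕ.+ m)) ~ vertex zero

IsTree : ∀ {n} → Graph n → Set
IsTree T = Connected T × ¬ Cycle T

-- A copy of T in the subgraph G of Γ.
record Copy {k n : ℕ} (T : Graph k) {Γ : Graph n} (G : Subgraph Γ) : Set where
  field
    embed     : Fin k → Fin n
    injective : Injective _≡_ _≡_ embed
    vertex    : ∀ v → embed v ∈ Subgraph.verts G
    edge      : ∀ {u v} → Graph._~_ T u v → Subgraph._~_ G (embed u) (embed v)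

-- The copy of T is an induced subgraph of the ambient graph Γ (not merely of
-- G): Γ has no edges between its vertices other than those of the copy.
IsInduced : ∀ {k n} {T : Graph k} {Γ : Graph n} {G : Subgraph Γ} → Copy T G → Set
IsInduced {T = T} {Γ = Γ} H =
  ∀ {u v} → Graph._~_ Γ (embed u) (embed v) → Graph._~_ T u v
  where open Copy H

ContainsInducedCopy : ∀ {k n} → Graph k → (Γ : Graph n) → Subgraph Γ → Set
ContainsInducedCopy T Γ G = Σ (Copy T G) IsInduced

-- Weight the homomorphisms of T into G by the random walk on G: a root is drawn
-- with weight deg, every further vertex uniformly among the G-neighbours of the
-- image of its parent. By reversibility the weight does not depend on the root,
-- so the vertex carrying the next leaf can be taken as the root. Relative to it
-- the other images remove their Γ-neighbours from its G-neighbourhood one after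
-- the other. By sparsity, given the earlier images, fewer than O(t) vertices
-- shrink the remaining candidates by more than a constant factor, and since an
-- image is uniform in a neighbourhood, the total weight of hitting one of them is
-- at most Σ_v deg v · O(t) / deg v = O(t n). Roots of degree below O(t) also weigh
-- O(t n). Outside these events a constant proportion of the neighbours extends the
-- induced copy, so the weight of induced copies of T is positive as soon as the
-- total weight 2e(G) exceeds a constant times t n.

module Submission where

import Algebra.Properties.Semiring.Sum as SemiringSum
open import Algebra.Bundles using (CommutativeRing)
open import Data.Bool.Base using (Bool; true; false; not; _∧_; _∨_; if_then_else_)
open import Data.Fin.Base using (Fin; zero; suc; inject₁; fromℕ)
open import Data.Fin.Properties as Finₚ using (_≟_)
open import Data.Fin.Subset using (∣_∣)
open import Data.Fin.Subset.Properties using (_∈?_)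
import Data.Integer.Base as ℤ
import Data.Integer.Properties as ℤₚ
open import Data.List.Base as List using (List; cartesianProduct; filter)
open import Data.List.Properties using (map-tabulate; filter-++; length-++)
open import Data.Nat.Base as ℕ using (ℕ; NonZero)
open import Data.Product.Base using (∃-syntax; Σ; _×_; _,_; proj₁; proj₂)
open import Data.Rational.Base as ℚ
  using (ℚ; 0ℚ; 1ℚ; _+_; _*_; _-_; _<_; _≤_; 1/_; nonNegative; positive)
open import Data.Rational.Properties as ℚₚ hiding (_≤?_; _<?_; _≟_)
open import Data.Rational.Solver using (module +-*-Solver)
import Data.Rational.Unnormalised.Base as ℚᵘ
import Data.Rational.Unnormalised.Properties as ℚᵘₚ
open import Data.Sum.Base using (_⊎_; inj₁; inj₂; map₂)
open import Data.Unit.Base using (⊤; tt)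
open import Data.Vec.Base as Vec using (Vec; lookup; _[_]≔_)
open import Data.Vec.Functional as Vector using ()
open import Data.Vec.Properties using ([]≔-commutes; lookup∘updateAt; lookup∘updateAt′)
open import Function.Base using (_∘_)
open import Function.Definitions using (Injective)
open import Relation.Binary.Construct.Closure.ReflexiveTransitive as Star using (Star)
open import Relation.Binary.Definitions using (Symmetric)
open import Relation.Binary.PropositionalEquality
open import Relation.Nullary using (¬_; Dec; yes; no; does; contradiction)
open import Relation.Nullary.Decidable using (dec-true; decidable-stable; does-≡; map′; _⊎-dec_)
open import Relation.Unary using (Pred; Decidable)
open import Defs

open +-*-Solver using (solve; _:+_; _:*_; _:-_; _:=_; con)
module Sum = SemiringSum (CommutativeRing.semiring +-*-commutativeRing)

-- Rational arithmetic and finite sums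

infix 4 _≤?_ _<?_

-- Opaque so that unification can read the summand off a sum, and so that
-- with-abstraction finds p ≤? q inside does (p ≤? q).
opaque

  _≤?_ : ∀ p q → Dec (p ≤ q)
  _≤?_ = ℚₚ._≤?_

  _<?_ : ∀ p q → Dec (p < q)
  _<?_ = ℚₚ._<?_

  sum : ∀ {n} → (Fin n → ℚ) → ℚ
  sum = Sum.sum

  sum-zero : (f : Fin 0 → ℚ) → sum f ≡ 0ℚ
  sum-zero f = refl

  sum-suc : ∀ {n} (f : Fin (ℕ.suc n) → ℚ) → sum f ≡ f zero + sum (f ∘ suc)
  sum-suc f = refl

  sum-cong : ∀ {n} {f g : Fin n → ℚ} → (∀ i → f i ≡ g i) → sum f ≡ sum g
  sum-cong = Sum.sum-cong-≗

  sum-comm : ∀ {m n} (f : Fin m → Fin n → ℚ) →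
             (sum λ i → sum λ j → f i j) ≡ (sum λ j → sum λ i → f i j)
  sum-comm = Sum.∑-comm

  sum-distrib-+ : ∀ {n} (f g : Fin n → ℚ) → (sum λ i → f i + g i) ≡ sum f + sum g
  sum-distrib-+ = Sum.∑-distrib-+

  *-distribˡ-sum : ∀ {n} c (f : Fin n → ℚ) → c * sum f ≡ sum λ i → c * f i
  *-distribˡ-sum = Sum.*-distribˡ-sum

*-monoˡ-≤ : ∀ {r p q} → 0ℚ ≤ r → p ≤ q → r * p ≤ r * q
*-monoˡ-≤ {r} 0≤r = *-monoˡ-≤-nonNeg r {{nonNegative 0≤r}}

*-monoʳ-≤ : ∀ {r p q} → 0ℚ ≤ r → p ≤ q → p * r ≤ q * r
*-monoʳ-≤ {r} 0≤r = *-monoʳ-≤-nonNeg r {{nonNegative 0≤r}}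

0≤p*q : ∀ {p q} → 0ℚ ≤ p → 0ℚ ≤ q → 0ℚ ≤ p * q
0≤p*q {p} {q} 0≤p 0≤q = subst (_≤ p * q) (*-zeroʳ p) (*-monoˡ-≤ 0≤p 0≤q)

0<p*q : ∀ {p q} → 0ℚ < p → 0ℚ < q → 0ℚ < p * q
0<p*q {p} {q} 0<p 0<q =
  subst (_< p * q) (*-zeroʳ p) (*-monoʳ-<-pos p {{positive 0<p}} 0<q)

0≤p+q : ∀ {p q} → 0ℚ ≤ p → 0ℚ ≤ q → 0ℚ ≤ p + q
0≤p+q = +-mono-≤

0≤1 : 0ℚ ≤ 1ℚ
0≤1 = nonNegative⁻¹ 1ℚ

0<1 : 0ℚ < 1ℚ
0<1 = positive⁻¹ 1ℚ

p≤p+q : ∀ {p q} → 0ℚ ≤ q → p ≤ p + q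
p≤p+q {p} {q} 0≤q = subst (_≤ p + q) (+-identityʳ p) (+-monoʳ-≤ p 0≤q)

q≤p+q : ∀ {p q} → 0ℚ ≤ p → q ≤ p + q
q≤p+q {p} {q} 0≤p = subst (_≤ p + q) (+-identityˡ q) (+-monoˡ-≤ q 0≤p)

0<p*q⇒0<q : ∀ {p q} → 0ℚ ≤ p → 0ℚ < p * q → 0ℚ < q
0<p*q⇒0<q {p} {q} 0≤p 0<pq with 0ℚ <? q
... | yes 0<q = 0<q
... | no  0≮q = contradiction
  (<-≤-trans 0<pq (subst (p * q ≤_) (*-zeroʳ p) (*-monoˡ-≤ 0≤p (≮⇒≥ 0≮q)))) (<-irrefl refl)

-- recip p = 0 for p ≤ 0; in particular averages over empty neighbourhoods vanish.
recip : ℚ → ℚ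
recip p with 0ℚ <? p
... | yes 0<p = (1/ p) {{pos⇒nonZero p {{positive 0<p}}}}
... | no  _   = 0ℚ

0≤recip : ∀ p → 0ℚ ≤ recip p
0≤recip p with 0ℚ <? p
... | yes 0<p = <⇒≤ (positive⁻¹ _ {{1/pos⇒pos p {{positive 0<p}}}})
... | no  _   = ≤-refl

*-recip : ∀ {p} → 0ℚ < p → p * recip p ≡ 1ℚ
*-recip {p} 0<p with 0ℚ <? p
... | yes 0<p′ = *-inverseʳ p {{pos⇒nonZero p {{positive 0<p′}}}}
... | no  0≮p  = contradiction 0<p 0≮p

p*recip≤1 : ∀ p → p * recip p ≤ 1ℚ
p*recip≤1 p with 0ℚ <? p
... | yes 0<p = ≤-reflexive (*-inverseʳ p {{pos⇒nonZero p {{positive 0<p}}}})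
... | no  _   = subst (_≤ 1ℚ) (sym (*-zeroʳ p)) 0≤1

opaque
  unfolding sum

  sum-const-0 : ∀ n → sum {n} (λ _ → 0ℚ) ≡ 0ℚ
  sum-const-0 = Sum.sum-replicate-zero

  sum-mono-≤ : ∀ {n} {f g : Fin n → ℚ} → (∀ i → f i ≤ g i) → sum f ≤ sum g
  sum-mono-≤ {ℕ.zero}  f≤g = ≤-refl
  sum-mono-≤ {ℕ.suc n} f≤g = +-mono-≤ (f≤g zero) (sum-mono-≤ (f≤g ∘ suc))

  0≤sum : ∀ {n} {f : Fin n → ℚ} → (∀ i → 0ℚ ≤ f i) → 0ℚ ≤ sum f
  0≤sum {ℕ.zero}  0≤f = ≤-refl
  0≤sum {ℕ.suc n} 0≤f = 0≤p+q (0≤f zero) (0≤sum (0≤f ∘ suc))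

  term≤sum : ∀ {n} {f : Fin n → ℚ} → (∀ i → 0ℚ ≤ f i) → ∀ i → f i ≤ sum f
  term≤sum 0≤f zero    = p≤p+q (0≤sum (0≤f ∘ suc))
  term≤sum 0≤f (suc i) = ≤-trans (term≤sum (0≤f ∘ suc) i) (q≤p+q (0≤f zero))

  0<sum⇒∃ : ∀ {n} {f : Fin n → ℚ} → 0ℚ < sum f → ∃[ i ] 0ℚ < f i
  0<sum⇒∃ {ℕ.zero}      0<Σ = contradiction 0<Σ (<-irrefl refl)
  0<sum⇒∃ {ℕ.suc n} {f} 0<Σ with 0ℚ <? f zero
  ... | yes 0<f₀ = zero , 0<f₀
  ... | no  0≮f₀ with 0<sum⇒∃ (<-≤-trans 0<Σ
          (subst (sum f ≤_) (+-identityˡ _) (+-monoˡ-≤ (sum (f ∘ suc)) (≮⇒≥ 0≮f₀))))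
  ...   | i , 0<fᵢ = suc i , 0<fᵢ

⟦_⟧ : Bool → ℚ
⟦ b ⟧ = if b then 1ℚ else 0ℚ

0≤⟦⟧ : ∀ b → 0ℚ ≤ ⟦ b ⟧
0≤⟦⟧ true  = 0≤1
0≤⟦⟧ false = ≤-refl

⟦⟧*p≤p : ∀ b {p} → 0ℚ ≤ p → ⟦ b ⟧ * p ≤ p
⟦⟧*p≤p true  {p} _   = ≤-reflexive (*-identityˡ p)
⟦⟧*p≤p false {p} 0≤p = subst (_≤ p) (sym (*-zeroˡ p)) 0≤p

size : ∀ {n} → (Fin n → Bool) → ℚ
size A = sum λ v → ⟦ A v ⟧

0≤size : ∀ {n} (A : Fin n → Bool) → 0ℚ ≤ size A
0≤size A = 0≤sum (0≤⟦⟧ ∘ A)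

-- Trees grown vertex by vertex

infixl 5 _▷_

-- The steps of growing a tree from a root: each pair is a new vertex with its parent.
data Steps (V : Set) : Set where
  ε   : Steps V
  _▷_ : Steps V → V × V → Steps V

infixr 5 _◁_

-- The new step comes before all others, so the root changes: with `e = (q , l)`, a tree grown from
-- `q` becomes one grown from `l` whose first new vertex is `q`.
_◁_ : ∀ {V} → V × V → Steps V → Steps V
e ◁ ε       = ε ▷ e
e ◁ (L ▷ f) = (e ◁ L) ▷ f

module _ {V : Set} where

  len : Steps V → ℕ
  len ε       = 0
  len (L ▷ _) = ℕ.suc (len L)

  Visits : V → Steps V → V → Set
  Visits r ε             v = v ≡ r
  Visits r (L ▷ (l , p)) v = v ≡ l ⊎ Visits r L v

  Grows : V → Steps V → Set
  Grows r ε             = ⊤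
  Grows r (L ▷ (l , p)) = Grows r L × ¬ Visits r L l × Visits r L p

  visits-root : ∀ {r} L → Visits r L r
  visits-root ε       = refl
  visits-root (L ▷ _) = inj₂ (visits-root L)

  visits-◁⁺ : ∀ {q l} L {v} → v ≡ l ⊎ Visits q L v → Visits l ((q , l) ◁ L) v
  visits-◁⁺ ε       (inj₁ v≡l)        = inj₂ v≡l
  visits-◁⁺ ε       (inj₂ v≡q)        = inj₁ v≡q
  visits-◁⁺ (L ▷ _) (inj₁ v≡l)        = inj₂ (visits-◁⁺ L (inj₁ v≡l))
  visits-◁⁺ (L ▷ _) (inj₂ (inj₁ v≡a)) = inj₁ v≡a
  visits-◁⁺ (L ▷ _) (inj₂ (inj₂ v∈L)) = inj₂ (visits-◁⁺ L (inj₂ v∈L))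

  visits-◁⁻ : ∀ {q l} L {v} → Visits l ((q , l) ◁ L) v → v ≡ l ⊎ Visits q L v
  visits-◁⁻ ε       (inj₁ v≡q) = inj₂ v≡q
  visits-◁⁻ ε       (inj₂ v≡l) = inj₁ v≡l
  visits-◁⁻ (L ▷ _) (inj₁ v≡a) = inj₂ (inj₁ v≡a)
  visits-◁⁻ (L ▷ _) (inj₂ v∈) with visits-◁⁻ L v∈
  ... | inj₁ v≡l = inj₁ v≡l
  ... | inj₂ v∈L = inj₂ (inj₂ v∈L)

  grows-◁ : ∀ {q l} L → Grows q L → ¬ Visits q L l → Grows l ((q , l) ◁ L)
  grows-◁ ε _ l∉ = tt , l∉ ∘ sym , refl
  grows-◁ {q} {l} (L ▷ (a , b)) (gr , a∉ , b∈) l∉ =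
      grows-◁ L gr (l∉ ∘ inj₂)
    , fresh ∘ visits-◁⁻ L
    , visits-◁⁺ L (inj₂ b∈)
    where
    fresh : ¬ (a ≡ l ⊎ Visits q L a)
    fresh (inj₁ a≡l) = l∉ (inj₁ (sym a≡l))
    fresh (inj₂ a∈L) = a∉ a∈L

  len-◁ : ∀ (e : V × V) L → len (e ◁ L) ≡ ℕ.suc (len L)
  len-◁ e ε       = refl
  len-◁ e (L ▷ _) = cong ℕ.suc (len-◁ e L)

  Edges : (V → V → Set) → Steps V → Set
  Edges R ε             = ⊤
  Edges R (L ▷ (l , p)) = Edges R L × R l p

  edges-◁ : ∀ {R q l} L → Edges R L → R q l → Edges R ((q , l) ◁ L)
  edges-◁ ε       _           ql = tt , ql
  edges-◁ (L ▷ _) (eds , ab) ql = edges-◁ L eds ql , ab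

  -- The same tree grown from `q`. The length is recorded because all later bounds depend on the
  -- tree only through it.
  record Rerooting (r : V) (L : Steps V) (q : V) : Set₁ where
    field
      steps   : Steps V
      grows   : Grows q steps
      visits⁺ : ∀ {v} → Visits r L v → Visits q steps v
      visits⁻ : ∀ {v} → Visits q steps v → Visits r L v
      length  : len steps ≡ len L
      edges   : ∀ {R} → Symmetric R → Edges R L → Edges R steps

  -- If `q` is the last leaf, the rest is rerooted at its parent and the joining edge, reversed, is
  -- put in front. Otherwise the last step stays last.
  reroot : ∀ r L → Grows r L → ∀ {q} → Visits r L q → Rerooting r L q
  reroot r ε _ refl = record
    { steps = ε ; grows = tt ; visits⁺ = λ v∈ → v∈ ; visits⁻ = λ v∈ → v∈
    ; length = refl ; edges = λ _ eds → eds }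
  reroot r (L ▷ (l , p)) (gr , l∉ , p∈) (inj₁ refl) = record
    { steps   = (p , l) ◁ steps
    ; grows   = grows-◁ steps grows (l∉ ∘ visits⁻)
    ; visits⁺ = λ { (inj₁ v≡l) → visits-◁⁺ steps (inj₁ v≡l)
                  ; (inj₂ v∈L) → visits-◁⁺ steps (inj₂ (visits⁺ v∈L)) }
    ; visits⁻ = map₂ visits⁻ ∘ visits-◁⁻ steps
    ; length  = trans (len-◁ _ steps) (cong ℕ.suc length)
    ; edges   = λ R-sym (eds , lp) → edges-◁ steps (edges R-sym eds) (R-sym lp)
    }
    where open Rerooting (reroot r L gr p∈)
  reroot r (L ▷ (l , p)) (gr , l∉ , p∈) (inj₂ q∈) = record
    { steps   = steps ▷ (l , p)
    ; grows   = grows , l∉ ∘ visits⁻ , visits⁺ p∈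
    ; visits⁺ = map₂ visits⁺
    ; visits⁻ = map₂ visits⁻
    ; length  = cong ℕ.suc length
    ; edges   = λ R-sym (eds , lp) → edges R-sym eds , lp
    }
    where open Rerooting (reroot r L gr q∈)

-- Constants of the induction on the number of steps

count : ℕ → ℚ
count ℕ.zero    = 0ℚ
count (ℕ.suc m) = count m + 1ℚ

pow : ℚ → ℕ → ℚ
pow K ℕ.zero    = 1ℚ
pow K (ℕ.suc m) = K * pow K m

-- Equal to `K` to the power 0 + 1 + ... + (m - 1): the step added to a tree with j steps costs a
-- factor `pow K j`.
gain : ℚ → ℕ → ℚ
gain K ℕ.zero    = 1ℚ
gain K (ℕ.suc m) = gain K m * pow K m

-- The accumulated weight of exceptional events in units of `s * order`: at a tree with j steps,
-- `pow K j` for low degree and `count j` for errors, scaled by the factors already paid.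
loss : ℚ → ℕ → ℚ
loss K ℕ.zero    = 0ℚ
loss K (ℕ.suc m) = loss K m + gain K m * (pow K m + count m)

0≤count : ∀ m → 0ℚ ≤ count m
0≤count ℕ.zero    = ≤-refl
0≤count (ℕ.suc m) = 0≤p+q (0≤count m) 0≤1

module _ {K : ℚ} (0<K : 0ℚ < K) where

  0<pow : ∀ m → 0ℚ < pow K m
  0<pow ℕ.zero    = 0<1
  0<pow (ℕ.suc m) = 0<p*q 0<K (0<pow m)

  0<gain : ∀ m → 0ℚ < gain K m
  0<gain ℕ.zero    = 0<1
  0<gain (ℕ.suc m) = 0<p*q (0<gain m) (0<pow m)

  0≤loss : ∀ m → 0ℚ ≤ loss K m
  0≤loss ℕ.zero    = ≤-refl
  0≤loss (ℕ.suc m) = 0≤p+q (0≤loss m)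
    (0≤p*q (<⇒≤ (0<gain m)) (0≤p+q (<⇒≤ (0<pow m)) (0≤count m)))

remove : ∀ {n} → (Fin n → Fin n → Bool) → (Fin n → Bool) → Fin n → Fin n → Bool
remove M A u w = A w ∧ not (M u w)

positive-indicator : ∀ {b} → 0ℚ < ⟦ b ⟧ → b ≡ true
positive-indicator {true}  _   = refl
positive-indicator {false} 0<0 = contradiction 0<0 (<-irrefl refl)

∧-true : ∀ {a b} → a ∧ b ≡ true → a ≡ true × b ≡ true
∧-true {true} {true} _ = refl , refl

-- The random-walk weight

module Walk {n k : ℕ} (g : Fin n → Fin n → Bool) (g-sym : ∀ u v → g u v ≡ g v u)
            (x₀ : Vec (Fin n) k) where

  V : Set
  V = Fin k

  X : Set
  X = Vec (Fin n) k

  deg : Fin n → ℚ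
  deg v = size (g v)

  0≤deg : ∀ v → 0ℚ ≤ deg v
  0≤deg v = 0≤size (g v)

  -- A neighbour `w` makes the degree of `v` positive; without one both sides vanish, whatever
  -- `recip` is.
  deg*recip*g : ∀ v w → deg v * (recip (deg v) * ⟦ g v w ⟧) ≡ ⟦ g v w ⟧
  deg*recip*g v w with g v w in eq
  ... | false = trans (cong (deg v *_) (*-zeroʳ (recip (deg v)))) (*-zeroʳ (deg v))
  ... | true  = trans (cong (deg v *_) (*-identityʳ (recip (deg v)))) (*-recip 0<d)
    where
    0<d : 0ℚ < deg v
    0<d = <-≤-trans (subst (λ b → 0ℚ < ⟦ b ⟧) (sym eq) 0<1) (term≤sum (0≤⟦⟧ ∘ g v) w)

  at-updated : ∀ (x : X) i y → lookup (x [ i ]≔ y) i ≡ y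
  at-updated x i y = lookup∘updateAt i x

  at-other : ∀ (x : X) {i j} y → i ≢ j → lookup (x [ j ]≔ y) i ≡ lookup x i
  at-other x {i} {j} y i≢j = lookup∘updateAt′ i j i≢j x

  -- Conditional expectation when the image of `l` is drawn uniformly among the neighbours of the
  -- image of `p` and all other images are fixed.
  Avg : V → V → (X → ℚ) → X → ℚ
  Avg l p F x = recip (deg (lookup x p)) * sum λ y → ⟦ g (lookup x p) y ⟧ * F (x [ l ]≔ y)

  -- The unnormalised expectation over the walk. The last step is the innermost average, and
  -- vertices outside the tree keep their default image from `x₀`.
  E : V → Steps V → (X → ℚ) → ℚ
  E r ε             F = sum λ y → deg y * F (x₀ [ r ]≔ y)
  E r (L ▷ (l , p)) F = E r L (Avg l p F)

  Avg-mono : ∀ l p {F H : X → ℚ} → (∀ x → F x ≤ H x) → ∀ x → Avg l p F x ≤ Avg l p H x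
  Avg-mono l p F≤H x = *-monoˡ-≤ (0≤recip (deg (lookup x p)))
    (sum-mono-≤ λ y → *-monoˡ-≤ (0≤⟦⟧ (g (lookup x p) y)) (F≤H _))

  E-mono : ∀ r L {F H : X → ℚ} → (∀ x → F x ≤ H x) → E r L F ≤ E r L H
  E-mono r ε F≤H = sum-mono-≤ λ y → *-monoˡ-≤ (0≤deg y) (F≤H _)
  E-mono r (L ▷ (l , p)) F≤H = E-mono r L (Avg-mono l p F≤H)

  E-cong : ∀ r L {F H : X → ℚ} → (∀ x → F x ≡ H x) → E r L F ≡ E r L H
  E-cong r L F≡H = ≤-antisym (E-mono r L (≤-reflexive ∘ F≡H)) (E-mono r L (≤-reflexive ∘ sym ∘ F≡H))

  sum-+ : ∀ {m} (w f h : Fin m → ℚ) →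
          (sum λ i → w i * (f i + h i)) ≡ (sum λ i → w i * f i) + (sum λ i → w i * h i)
  sum-+ w f h = trans (sum-cong λ i → *-distribˡ-+ (w i) (f i) (h i))
                      (sum-distrib-+ (λ i → w i * f i) (λ i → w i * h i))

  sum-* : ∀ {m} c (w f : Fin m → ℚ) → (sum λ i → w i * (c * f i)) ≡ c * (sum λ i → w i * f i)
  sum-* c w f = trans (sum-cong λ i → solve 3 (λ c w f → w :* (c :* f) := c :* (w :* f)) refl c (w i) (f i))
                      (sym (*-distribˡ-sum c (λ i → w i * f i)))

  E-+ : ∀ r L (F H : X → ℚ) → E r L (λ x → F x + H x) ≡ E r L F + E r L H
  E-+ r ε F H = sum-+ deg _ _
  E-+ r (L ▷ (l , p)) F H = trans
    (E-cong r L λ x → trans (cong (recip (deg (lookup x p)) *_) (sum-+ (λ y → ⟦ g (lookup x p) y ⟧) _ _))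
                            (*-distribˡ-+ (recip (deg (lookup x p))) _ _))
    (E-+ r L (Avg l p F) (Avg l p H))

  E-* : ∀ r L c (F : X → ℚ) → E r L (λ x → c * F x) ≡ c * E r L F
  E-* r ε c F = sum-* c deg _
  E-* r (L ▷ (l , p)) c F = trans
    (E-cong r L λ x → trans (cong (recip (deg (lookup x p)) *_) (sum-* c (λ y → ⟦ g (lookup x p) y ⟧) _))
                            (swap* (recip (deg (lookup x p))) c _))
    (E-* r L c (Avg l p F))
    where
    swap* : ∀ a b d → a * (b * d) ≡ b * (a * d)
    swap* = solve 3 (λ a b d → a :* (b :* d) := b :* (a :* d)) refl

  0<E⇒∃ : ∀ r L {F : X → ℚ} → 0ℚ < E r L F → ∃[ x ] 0ℚ < F x
  0<E⇒∃ r ε 0<E with 0<sum⇒∃ 0<E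
  ... | y , 0<t = _ , 0<p*q⇒0<q (0≤deg y) 0<t
  0<E⇒∃ r (L ▷ (l , p)) 0<E with 0<E⇒∃ r L 0<E
  ... | x , 0<A with 0<sum⇒∃ (0<p*q⇒0<q (0≤recip (deg (lookup x p))) 0<A)
  ...   | y , 0<t = _ , 0<p*q⇒0<q (0≤⟦⟧ (g (lookup x p) y)) 0<t

  -- Neither new vertex is the parent of the other, so neither draw changes the distribution of the
  -- other and the two sums can be exchanged.
  Avg-comm : ∀ {l q a b} → l ≢ a → l ≢ b → a ≢ q → ∀ F x →
             Avg a b (Avg l q F) x ≡ Avg l q (Avg a b F) x
  Avg-comm {l} {q} {a} {b} l≢a l≢b a≢q F x = begin
    rb * (sum λ z → gb z * Avg l q F (x [ a ]≔ z))
      ≡⟨ cong (rb *_) (sum-cong λ z → cong (gb z *_) (inner z)) ⟩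
    rb * (sum λ z → gb z * (rq * sum λ y → gq y * F (x [ a ]≔ z [ l ]≔ y)))
      ≡⟨ cong (rb *_) (sum-* rq gb _) ⟩
    rb * (rq * sum λ z → gb z * sum λ y → gq y * F (x [ a ]≔ z [ l ]≔ y))
      ≡⟨ solve 3 (λ a b c → a :* (b :* c) := b :* (a :* c)) refl rb rq _ ⟩
    rq * (rb * sum λ z → gb z * sum λ y → gq y * F (x [ a ]≔ z [ l ]≔ y))
      ≡⟨ cong (λ s → rq * (rb * s)) swap ⟩
    rq * (rb * sum λ y → gq y * sum λ z → gb z * F (x [ l ]≔ y [ a ]≔ z))
      ≡⟨ cong (rq *_) (sum-* rb gq _) ⟨
    rq * (sum λ y → gq y * (rb * sum λ z → gb z * F (x [ l ]≔ y [ a ]≔ z)))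
      ≡⟨ cong (rq *_) (sum-cong λ y → cong (gq y *_) (inner′ y)) ⟨
    rq * (sum λ y → gq y * Avg a b F (x [ l ]≔ y)) ∎
    where
    open ≡-Reasoning
    rb = recip (deg (lookup x b))
    rq = recip (deg (lookup x q))
    gb = λ z → ⟦ g (lookup x b) z ⟧
    gq = λ y → ⟦ g (lookup x q) y ⟧
    inner : ∀ z → Avg l q F (x [ a ]≔ z) ≡ rq * sum λ y → gq y * F (x [ a ]≔ z [ l ]≔ y)
    inner z rewrite at-other x z (a≢q ∘ sym) = refl
    inner′ : ∀ y → Avg a b F (x [ l ]≔ y) ≡ rb * sum λ z → gb z * F (x [ l ]≔ y [ a ]≔ z)
    inner′ y rewrite at-other x y (l≢b ∘ sym) = refl
    swap : (sum λ z → gb z * sum λ y → gq y * F (x [ a ]≔ z [ l ]≔ y)) ≡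
           (sum λ y → gq y * sum λ z → gb z * F (x [ l ]≔ y [ a ]≔ z))
    swap = begin
      (sum λ z → gb z * sum λ y → gq y * F (x [ a ]≔ z [ l ]≔ y))
        ≡⟨ sum-cong (λ z → *-distribˡ-sum (gb z) _) ⟩
      (sum λ z → sum λ y → gb z * (gq y * F (x [ a ]≔ z [ l ]≔ y)))
        ≡⟨ sum-comm _ ⟩
      (sum λ y → sum λ z → gb z * (gq y * F (x [ a ]≔ z [ l ]≔ y)))
        ≡⟨ sum-cong (λ y → sum-cong λ z → trans
             (solve 3 (λ a b c → a :* (b :* c) := b :* (a :* c)) refl (gb z) (gq y) _)
             (cong (λ x′ → gq y * (gb z * F x′)) ([]≔-commutes x a l (l≢a ∘ sym)))) ⟩
      (sum λ y → sum λ z → gq y * (gb z * F (x [ l ]≔ y [ a ]≔ z)))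
        ≡⟨ sum-cong (λ y → *-distribˡ-sum (gq y) _) ⟨
      (sum λ y → gq y * sum λ z → gb z * F (x [ l ]≔ y [ a ]≔ z)) ∎

  -- Reversibility of the walk: the degree weight of the root cancels the uniform choice of its
  -- neighbour, leaving the symmetric weight `⟦ g y z ⟧`.
  E-flip : ∀ {q l} → q ≢ l → ∀ F → E q (ε ▷ (l , q)) F ≡ E l (ε ▷ (q , l)) F
  E-flip {q} {l} q≢l F = begin
    E q (ε ▷ (l , q)) F
      ≡⟨ unfold q l ⟩
    (sum λ y → sum λ z → ⟦ g y z ⟧ * F (x₀ [ q ]≔ y [ l ]≔ z))
      ≡⟨ sum-comm _ ⟩
    (sum λ z → sum λ y → ⟦ g y z ⟧ * F (x₀ [ q ]≔ y [ l ]≔ z))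
      ≡⟨ sum-cong (λ z → sum-cong λ y →
           cong₂ (λ b x → ⟦ b ⟧ * F x) (g-sym y z) ([]≔-commutes x₀ q l q≢l)) ⟩
    (sum λ z → sum λ y → ⟦ g z y ⟧ * F (x₀ [ l ]≔ z [ q ]≔ y))
      ≡⟨ unfold l q ⟨
    E l (ε ▷ (q , l)) F ∎
    where
    open ≡-Reasoning
    unfold : ∀ q l → E q (ε ▷ (l , q)) F ≡ sum λ y → sum λ z → ⟦ g y z ⟧ * F (x₀ [ q ]≔ y [ l ]≔ z)
    unfold q l = sum-cong λ y → begin
      deg y * Avg l q F (x₀ [ q ]≔ y)
        ≡⟨ cong (λ v → deg y * (recip (deg v) * sum λ z → ⟦ g v z ⟧ * F (x₀ [ q ]≔ y [ l ]≔ z)))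
                (at-updated x₀ q y) ⟩
      deg y * (recip (deg y) * sum λ z → ⟦ g y z ⟧ * F (x₀ [ q ]≔ y [ l ]≔ z))
        ≡⟨ trans (sym (*-assoc (deg y) _ _)) (*-distribˡ-sum (deg y * recip (deg y)) _) ⟩
      (sum λ z → deg y * recip (deg y) * (⟦ g y z ⟧ * F (x₀ [ q ]≔ y [ l ]≔ z)))
        ≡⟨ sum-cong (λ z → trans
             (solve 4 (λ d r b f → d :* r :* (b :* f) := d :* (r :* b) :* f) refl
               (deg y) (recip (deg y)) ⟦ g y z ⟧ _)
             (cong (_* _) (deg*recip*g y z))) ⟩
      (sum λ z → ⟦ g y z ⟧ * F (x₀ [ q ]≔ y [ l ]≔ z)) ∎

  -- The draw of `l` hangs on the root, so it commutes past every step of `L` to the front, where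
  -- `E-flip` exchanges it with the draw of the root.
  E-◁ : ∀ {q l} L → Grows q L → ¬ Visits q L l → ∀ F → E q (L ▷ (l , q)) F ≡ E l ((q , l) ◁ L) F
  E-◁ ε gr l∉ F = E-flip (l∉ ∘ sym) F
  E-◁ {q} {l} (L ▷ (a , b)) (gr , a∉ , b∈) l∉ F = trans
    (E-cong q L (Avg-comm (l∉ ∘ inj₁)
                          (λ l≡b → l∉ (inj₂ (subst (Visits q L) (sym l≡b) b∈)))
                          (λ a≡q → a∉ (subst (Visits q L) (sym a≡q) (visits-root L))) F))
    (E-◁ L gr (l∉ ∘ inj₂) (Avg a b F))

  E-reroot : ∀ r L gr {q} (q∈ : Visits r L q) F →
             E r L F ≡ E q (Rerooting.steps (reroot r L gr q∈)) F
  E-reroot r ε _ refl F = refl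
  E-reroot r (L ▷ (l , p)) (gr , l∉ , p∈) (inj₁ refl) F =
    trans (E-reroot r L gr p∈ (Avg l p F)) (E-◁ steps grows (l∉ ∘ visits⁻) F)
    where open Rerooting (reroot r L gr p∈)
  E-reroot r (L ▷ (l , p)) (gr , l∉ , p∈) (inj₂ q∈) F = E-reroot r L gr q∈ (Avg l p F)

  Ignores : V → (X → ℚ) → Set
  Ignores a F = ∀ x y → F (x [ a ]≔ y) ≡ F x

  -- Only an inequality, because the average is zero when the image of `p` is isolated.
  Avg-ignores-≤ : ∀ {l p F} → (∀ x → 0ℚ ≤ F x) → Ignores l F → ∀ x → Avg l p F x ≤ F x
  Avg-ignores-≤ {l} {p} {F} 0≤F ign x = begin
    recip d * (sum λ y → ⟦ g v y ⟧ * F (x [ l ]≔ y))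
      ≡⟨ cong (recip d *_) (trans (sum-cong λ y → trans (*-comm ⟦ g v y ⟧ _) (cong (_* ⟦ g v y ⟧) (ign x y)))
                                  (sym (*-distribˡ-sum (F x) _))) ⟩
    recip d * (F x * d)
      ≡⟨ solve 3 (λ r f d → r :* (f :* d) := d :* r :* f) refl (recip d) (F x) d ⟩
    d * recip d * F x
      ≤⟨ *-monoʳ-≤ (0≤F x) (p*recip≤1 d) ⟩
    1ℚ * F x
      ≡⟨ *-identityˡ (F x) ⟩
    F x ∎
    where
    open ≤-Reasoning
    v = lookup x p
    d = deg v

  E-marginal-root : ∀ q L → Grows q L → (f : Fin n → ℚ) → (∀ v → 0ℚ ≤ f v) →
                    E q L (λ x → f (lookup x q)) ≤ sum λ v → deg v * f v
  E-marginal-root q ε _ f 0≤f = ≤-reflexive (sum-cong λ y → cong (λ v → deg y * f v) (at-updated x₀ q y))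
  E-marginal-root q (L ▷ (l , p)) (gr , l∉ , p∈) f 0≤f = ≤-trans
    (E-mono q L (Avg-ignores-≤ (λ x → 0≤f (lookup x q)) λ x y → cong f (at-other x y
       (λ q≡l → l∉ (subst (Visits q L) q≡l (visits-root L))))))
    (E-marginal-root q L gr f 0≤f)

  -- With `b` made the root, its image is drawn with weight `deg`, and the remaining draws can only
  -- lose mass.
  E-marginal : ∀ r L → Grows r L → ∀ {b} → Visits r L b → (f : Fin n → ℚ) → (∀ v → 0ℚ ≤ f v) →
               E r L (λ x → f (lookup x b)) ≤ sum λ v → deg v * f v
  E-marginal r L gr {b} b∈ f 0≤f = subst (_≤ _) (sym (E-reroot r L gr b∈ _)) (E-marginal-root b steps grows f 0≤f)
    where open Rerooting (reroot r L gr b∈)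

  -- Candidate sets and the extension step

  module Blocking
    (M : Fin n → Fin n → Bool) {s K : ℚ} (0<s : 0ℚ < s) (1≤K : 1ℚ ≤ K)
    (few-bad : ∀ A → s ≤ size A → size (λ u → does (K * size (remove M A u) <? size A)) ≤ s)
    where

    -- The guard on the size of `A` is there because `few-bad` says nothing about small sets.
    bad : (Fin n → Bool) → Fin n → Bool
    bad A u = does (s ≤? size A) ∧ does (K * size (remove M A u) <? size A)

    size-bad : ∀ A → size (bad A) ≤ s
    size-bad A with s ≤? size A
    ... | yes s≤A = few-bad A s≤A
    ... | no  _   = ≤-trans (≤-reflexive (sum-const-0 n)) (<⇒≤ 0<s)

    -- The possible images of a further leaf attached at the root `q`. The image of `q` itself
    -- removes nothing, since the leaf must be adjacent to it.
    cand : V → Steps V → X → Fin n → Bool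
    cand q ε             x = g (lookup x q)
    cand q (L ▷ (a , _)) x = remove M (cand q L x) (lookup x a)

    cand⇒adjacent : ∀ q L {x w} → cand q L x w ≡ true → g (lookup x q) w ≡ true
    cand⇒adjacent q ε c = c
    cand⇒adjacent q (L ▷ _) c = cand⇒adjacent q L (proj₁ (∧-true c))

    -- Counts the images that are bad for the candidates left over by the earlier ones.
    errors : V → Steps V → X → ℚ
    errors q ε             x = 0ℚ
    errors q (L ▷ (a , _)) x = errors q L x + ⟦ bad (cand q L x) (lookup x a) ⟧

    cand-ignores : ∀ q L {v} → ¬ Visits q L v → ∀ x y → cand q L (x [ v ]≔ y) ≡ cand q L x
    cand-ignores q ε v∉ x y = cong g (at-other x y (v∉ ∘ sym))
    cand-ignores q (L ▷ (a , _)) v∉ x y =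
      cong₂ (remove M) (cand-ignores q L (v∉ ∘ inj₂) x y) (at-other x y (v∉ ∘ inj₁ ∘ sym))

    errors-ignores : ∀ q L {v} → ¬ Visits q L v → Ignores v (errors q L)
    errors-ignores q ε v∉ x y = refl
    errors-ignores q (L ▷ (a , _)) v∉ x y =
      cong₂ _+_ (errors-ignores q L (v∉ ∘ inj₂) x y)
        (cong₂ (λ A u → ⟦ bad A u ⟧) (cand-ignores q L (v∉ ∘ inj₂) x y) (at-other x y (v∉ ∘ inj₁ ∘ sym)))

    0≤errors : ∀ q L x → 0ℚ ≤ errors q L x
    0≤errors q ε x = ≤-refl
    0≤errors q (L ▷ (a , _)) x = 0≤p+q (0≤errors q L x) (0≤⟦⟧ (bad (cand q L x) (lookup x a)))

    -- The candidate set does not depend on the image of `a`, so at most `s` values are bad, each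
    -- drawn with probability at most the reciprocal degree.
    Avg-bad : ∀ q L {a} b → ¬ Visits q L a → ∀ x →
              Avg a b (λ x → ⟦ bad (cand q L x) (lookup x a) ⟧) x ≤ s * recip (deg (lookup x b))
    Avg-bad q L {a} b a∉ x = begin
      recip d * (sum λ y → ⟦ g v y ⟧ * ⟦ bad (cand q L (x [ a ]≔ y)) (lookup (x [ a ]≔ y) a) ⟧)
        ≤⟨ *-monoˡ-≤ (0≤recip d) (sum-mono-≤ λ y → ⟦⟧*p≤p (g v y) (0≤⟦⟧ (bad _ (lookup (x [ a ]≔ y) a)))) ⟩
      recip d * (sum λ y → ⟦ bad (cand q L (x [ a ]≔ y)) (lookup (x [ a ]≔ y) a) ⟧)
        ≡⟨ cong (recip d *_) (sum-cong λ y →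
             cong₂ (λ A u → ⟦ bad A u ⟧) (cand-ignores q L a∉ x y) (at-updated x a y)) ⟩
      recip d * size (bad (cand q L x))
        ≤⟨ *-monoˡ-≤ (0≤recip d) (size-bad (cand q L x)) ⟩
      recip d * s
        ≡⟨ *-comm (recip d) s ⟩
      s * recip d ∎
      where
      open ≤-Reasoning
      v = lookup x b
      d = deg v

    order : ℚ
    order = sum {n} λ _ → 1ℚ

    -- The degree weight of the marginal cancels the reciprocal, so each vertex of the host graph
    -- contributes at most one.
    E-recip : ∀ r L → Grows r L → ∀ {b} → Visits r L b →
              E r L (λ x → recip (deg (lookup x b))) ≤ order
    E-recip r L gr b∈ = ≤-trans (E-marginal r L gr b∈ (recip ∘ deg) (0≤recip ∘ deg))
                                (sum-mono-≤ (p*recip≤1 ∘ deg))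

    -- Each step adds at most `s * order`, by `Avg-bad` followed by `E-recip`.
    E-errors : ∀ q L → Grows q L → E q L (errors q L) ≤ count (len L) * (s * order)
    E-errors q ε _ = ≤-trans (≤-reflexive (trans (sum-cong λ y → *-zeroʳ (deg y)) (sum-const-0 n)))
                             (≤-reflexive (sym (*-zeroˡ (s * order))))
    E-errors q (L ▷ (a , b)) (gr , a∉ , b∈) = begin
      E q (L ▷ (a , b)) (errors q (L ▷ (a , b)))
        ≡⟨ E-+ q (L ▷ (a , b)) (errors q L) (λ x → ⟦ bad (cand q L x) (lookup x a) ⟧) ⟩
      E q L (Avg a b (errors q L)) + E q L (Avg a b (λ x → ⟦ bad (cand q L x) (lookup x a) ⟧))
        ≤⟨ +-mono-≤ (E-mono q L (Avg-ignores-≤ (0≤errors q L) (errors-ignores q L a∉)))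
                    (E-mono q L (Avg-bad q L b a∉)) ⟩
      E q L (errors q L) + E q L (λ x → s * recip (deg (lookup x b)))
        ≤⟨ +-mono-≤ (E-errors q L gr) (≤-trans (≤-reflexive (E-* q L s _))
                                               (*-monoˡ-≤ (<⇒≤ 0<s) (E-recip q L gr b∈))) ⟩
      count (len L) * (s * order) + s * order
        ≡⟨ solve 2 (λ c t → c :* t :+ t := (c :+ con 1ℚ) :* t) refl (count (len L)) (s * order) ⟩
      (count (len L) + 1ℚ) * (s * order) ∎
      where open ≤-Reasoning

    0<K : 0ℚ < K
    0<K = <-≤-trans 0<1 1≤K

    pow-suc : ∀ m → pow K m ≤ pow K (ℕ.suc m)
    pow-suc m = subst (_≤ K * pow K m) (*-identityˡ _) (*-monoʳ-≤ (<⇒≤ (0<pow 0<K m)) 1≤K)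

    -- Without errors every image shrinks the candidates by a factor of at most `K`. The degree is
    -- large enough that at least `s` candidates remain before each step, as the guard in `bad`
    -- requires.
    shrink : ∀ q L x → pow K (len L) * s ≤ deg (lookup x q) →
             1ℚ ≤ errors q L x ⊎ deg (lookup x q) ≤ pow K (len L) * size (cand q L x)
    shrink q ε x _ = inj₂ (≤-reflexive (sym (*-identityˡ (deg (lookup x q)))))
    shrink q (L ▷ (a , b)) x large
      with large′ ← ≤-trans (*-monoʳ-≤ (<⇒≤ 0<s) (pow-suc (len L))) large
      with shrink q L x large′
    ... | inj₁ 1≤err = inj₁ (≤-trans 1≤err (p≤p+q (0≤⟦⟧ (bad (cand q L x) (lookup x a)))))
    ... | inj₂ d≤
      with s ≤? size (cand q L x)
         | K * size (remove M (cand q L x) (lookup x a)) <? size (cand q L x)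
    -- Here `large′` and `d≤` together bound `pow K (len L) * s` by `pow K (len L)` times the number
    -- of candidates; cancelling the power leaves at least `s` of them.
    ... | no s≰  | _     = contradiction
      (*-cancelˡ-≤-pos (pow K (len L)) {{positive (0<pow 0<K (len L))}} (≤-trans large′ d≤)) s≰
    ... | yes _  | yes _ = inj₁ (q≤p+q (0≤errors q L x))
    ... | yes _  | no K≮ = inj₂ (begin
      deg (lookup x q)                  ≤⟨ d≤ ⟩
      P * size A                        ≤⟨ *-monoˡ-≤ (<⇒≤ (0<pow 0<K (len L))) (≮⇒≥ K≮) ⟩
      P * (K * size A′)                 ≡⟨ solve 3 (λ p k a → p :* (k :* a) := k :* p :* a) refl P K (size A′) ⟩
      K * P * size A′                   ∎)
      where
      open ≤-Reasoning
      P = pow K (len L)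
      A = cand q L x
      A′ = remove M A (lookup x a)

    low : ℚ → Fin n → Bool
    low D v = does (deg v <? D)

    -- In the marginal a vertex of degree below `D` has weight below `D`.
    E-low : ∀ r L → Grows r L → ∀ {b} → Visits r L b → ∀ {D} → 0ℚ ≤ D →
            E r L (λ x → ⟦ low D (lookup x b) ⟧) ≤ D * order
    E-low r L gr {b} b∈ {D} 0≤D = begin
      E r L (λ x → ⟦ low D (lookup x b) ⟧)  ≤⟨ E-marginal r L gr b∈ (⟦_⟧ ∘ low D) (0≤⟦⟧ ∘ low D) ⟩
      (sum λ v → deg v * ⟦ low D v ⟧)       ≤⟨ sum-mono-≤ bound ⟩
      (sum λ _ → D * 1ℚ)                    ≡⟨ *-distribˡ-sum D (λ _ → 1ℚ) ⟨
      D * order                             ∎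
      where
      open ≤-Reasoning
      bound : ∀ v → deg v * ⟦ low D v ⟧ ≤ D * 1ℚ
      bound v with deg v <? D
      ... | yes d<D = *-monoʳ-≤ 0≤1 (<⇒≤ d<D)
      ... | no  _   = subst (_≤ D * 1ℚ) (sym (*-zeroʳ (deg v))) (0≤p*q 0≤D 0≤1)

    -- Every new vertex passes the test from the tree rerooted at its parent. Isolated
    -- vertices of G are excluded as roots because they need not belong to G's vertex set.
    good : ∀ r L → Grows r L → X → Bool
    good r ε             _               x = does (0ℚ <? deg (lookup x r))
    good r (L ▷ (l , p)) (gr , l∉ , p∈) x =
      good r L gr x ∧ cand p (Rerooting.steps (reroot r L gr p∈)) x (lookup x l)

    good-ignores : ∀ r L gr {v} → ¬ Visits r L v → ∀ x y → good r L gr (x [ v ]≔ y) ≡ good r L gr x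
    good-ignores r ε _ v∉ x y = cong (λ v → does (0ℚ <? deg v)) (at-other x y (v∉ ∘ sym))
    good-ignores r (L ▷ (l , p)) (gr , l∉ , p∈) v∉ x y =
      cong₂ _∧_ (good-ignores r L gr (v∉ ∘ inj₂) x y)
        (cong₂ (λ A w → A w) (cand-ignores p steps (v∉ ∘ inj₂ ∘ visits⁻) x y)
                             (at-other x y (v∉ ∘ inj₁ ∘ sym)))
      where open Rerooting (reroot r L gr p∈)

    module Step (r : V) (L : Steps V) (l p : V) (gr⁺ : Grows r (L ▷ (l , p))) where

      open Rerooting (reroot r L (proj₁ gr⁺) (proj₂ (proj₂ gr⁺)))

      gr = proj₁ gr⁺
      l∉ = proj₁ (proj₂ gr⁺)
      p∈ = proj₂ (proj₂ gr⁺)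

      P : ℚ
      P = pow K (len L)

      0≤P : 0ℚ ≤ P
      0≤P = <⇒≤ (0<pow 0<K (len L))

      good⁺ : X → Bool
      good⁺ = good r (L ▷ (l , p)) gr⁺

      0≤Avg : ∀ x → 0ℚ ≤ P * Avg l p (⟦_⟧ ∘ good⁺) x
      0≤Avg x = 0≤p*q 0≤P (0≤p*q (0≤recip (deg (lookup x p)))
        (0≤sum λ y → 0≤p*q (0≤⟦⟧ (g (lookup x p) y)) (0≤⟦⟧ (good⁺ (x [ l ]≔ y)))))

      -- Every candidate is a neighbour of the image of `p` and yields a good extension, and the
      -- candidates form at least a `1 / P` share of the neighbours.
      extend : ∀ x → good r L gr x ≡ true → P * s ≤ deg (lookup x p) →
               deg (lookup x p) ≤ P * size (cand p steps x) →
               1ℚ ≤ P * Avg l p (⟦_⟧ ∘ good⁺) x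
      extend x ok large d≤ = begin
        1ℚ
          ≡⟨ *-recip 0<d ⟨
        d * recip d
          ≤⟨ *-monoʳ-≤ (0≤recip d) d≤ ⟩
        P * size C * recip d
          ≡⟨ solve 3 (λ p c r → p :* c :* r := p :* (r :* c)) refl P (size C) (recip d) ⟩
        P * (recip d * size C)
          ≤⟨ *-monoˡ-≤ 0≤P (*-monoˡ-≤ (0≤recip d) (sum-mono-≤ bound)) ⟩
        P * Avg l p (⟦_⟧ ∘ good⁺) x ∎
        where
        open ≤-Reasoning
        d = deg (lookup x p)
        C = cand p steps x
        0<d : 0ℚ < d
        0<d = <-≤-trans (0<p*q (0<pow 0<K (len L)) 0<s) large
        good⁺-eq : ∀ w → good⁺ (x [ l ]≔ w) ≡ C w
        good⁺-eq w = cong₂ _∧_ (trans (good-ignores r L gr l∉ x w) ok)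
          (cong₂ (λ A w → A w) (cand-ignores p steps (l∉ ∘ visits⁻) x w) (at-updated x l w))
        bound : ∀ w → ⟦ C w ⟧ ≤ ⟦ g (lookup x p) w ⟧ * ⟦ good⁺ (x [ l ]≔ w) ⟧
        bound w rewrite good⁺-eq w with C w in c
        ... | false = 0≤p*q (0≤⟦⟧ (g (lookup x p) w)) ≤-refl
        ... | true rewrite cand⇒adjacent p steps c = ≤-refl

      -- A union bound: a good assignment has a parent image of low degree, or commits an error, or
      -- extends for a constant proportion of draws.
      pointwise : ∀ x → ⟦ good r L gr x ⟧ ≤
                  ⟦ low (P * s) (lookup x p) ⟧ + (errors p steps x + P * Avg l p (⟦_⟧ ∘ good⁺) x)
      pointwise x with good r L gr x in ok
      ... | false = 0≤p+q (0≤⟦⟧ (low (P * s) (lookup x p))) (0≤p+q (0≤errors p steps x) (0≤Avg x))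
      ... | true with deg (lookup x p) <? P * s
      ...   | yes _ = p≤p+q (0≤p+q (0≤errors p steps x) (0≤Avg x))
      ...   | no d≮ = ≤-trans (cases (shrink′ x (≮⇒≥ d≮))) (≤-reflexive (sym (+-identityˡ _)))
        where
        shrink′ : ∀ x → P * s ≤ deg (lookup x p) →
                  1ℚ ≤ errors p steps x ⊎ deg (lookup x p) ≤ P * size (cand p steps x)
        shrink′ x = subst (λ m → pow K m * s ≤ deg (lookup x p) →
                    1ℚ ≤ errors p steps x ⊎ deg (lookup x p) ≤ pow K m * size (cand p steps x))
                    length (shrink p steps x)
        cases : 1ℚ ≤ errors p steps x ⊎ deg (lookup x p) ≤ P * size (cand p steps x) →
                1ℚ ≤ errors p steps x + P * Avg l p (⟦_⟧ ∘ good⁺) x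
        cases (inj₁ 1≤err) = ≤-trans 1≤err (p≤p+q (0≤Avg x))
        cases (inj₂ d≤)    = ≤-trans (extend x ok (≮⇒≥ d≮) d≤) (q≤p+q (0≤errors p steps x))

      E-step : E r L (⟦_⟧ ∘ good r L gr) ≤
               (P + count (len L)) * (s * order) + P * E r (L ▷ (l , p)) (⟦_⟧ ∘ good⁺)
      E-step = begin
        E r L (⟦_⟧ ∘ good r L gr)
          ≤⟨ E-mono r L pointwise ⟩
        E r L (λ x → isLow x + (errors p steps x + P * Avg l p (⟦_⟧ ∘ good⁺) x))
          ≡⟨ trans (E-+ r L isLow _) (cong (E r L isLow +_)
               (trans (E-+ r L (errors p steps) _) (cong (E r L (errors p steps) +_) (E-* r L P _)))) ⟩
        E r L isLow + (E r L (errors p steps) + P * E⁺)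
          ≤⟨ +-mono-≤ (E-low r L gr p∈ (0≤p*q 0≤P (<⇒≤ 0<s)))
                      -- Errors are counted along the tree rooted at `p`, while the expectation is
                      -- taken from `r`; the weight is the same from either root.
                      (+-monoˡ-≤ (P * E⁺) (≤-trans (≤-reflexive (E-reroot r L gr p∈ (errors p steps)))
                        (subst (λ m → E p steps (errors p steps) ≤ count m * (s * order)) length
                               (E-errors p steps grows)))) ⟩
        P * s * order + (count (len L) * (s * order) + P * E⁺)
          ≡⟨ solve 5 (λ P s o c e → P :* s :* o :+ (c :* (s :* o) :+ e) := (P :+ c) :* (s :* o) :+ e)
               refl P s order (count (len L)) (P * E⁺) ⟩
        (P + count (len L)) * (s * order) + P * E⁺ ∎
        where
        open ≤-Reasoning
        E⁺ = E r (L ▷ (l , p)) (⟦_⟧ ∘ good⁺)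
        isLow = λ x → ⟦ low (P * s) (lookup x p) ⟧

    -- Iterates `E-step`. For a single vertex nothing is lost, as the excluded isolated roots have
    -- weight zero.
    E-good : ∀ r L gr → sum deg ≤ loss K (len L) * (s * order) + gain K (len L) * E r L (⟦_⟧ ∘ good r L gr)
    E-good r ε _ = ≤-reflexive (trans (sum-cong positive-part)
      (solve 2 (λ S t → S := con 0ℚ :* t :+ con 1ℚ :* S) refl (E r ε (⟦_⟧ ∘ good r ε _)) (s * order)))
      where
      positive-part : ∀ v → deg v ≡ deg v * ⟦ does (0ℚ <? deg (lookup (x₀ [ r ]≔ v) r)) ⟧
      positive-part v rewrite at-updated x₀ r v with 0ℚ <? deg v
      ... | yes _   = sym (*-identityʳ (deg v))
      ... | no  0≮d = trans (≤-antisym (≮⇒≥ 0≮d) (0≤deg v)) (sym (*-zeroʳ (deg v)))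
    E-good r (L ▷ (l , p)) gr⁺@(gr , _) = begin
      sum deg
        ≤⟨ E-good r L gr ⟩
      loss K m * (s * order) + gain K m * E r L (⟦_⟧ ∘ good r L gr)
        ≤⟨ +-monoʳ-≤ (loss K m * (s * order)) (*-monoˡ-≤ (<⇒≤ (0<gain 0<K m)) (Step.E-step r L l p gr⁺)) ⟩
      loss K m * (s * order) + gain K m * ((pow K m + count m) * (s * order) + pow K m * E⁺)
        ≡⟨ solve 6 (λ a b h t p e → a :* t :+ b :* (h :* t :+ p :* e) := (a :+ b :* h) :* t :+ b :* p :* e)
             refl (loss K m) (gain K m) (pow K m + count m) (s * order) (pow K m) E⁺ ⟩
      loss K (ℕ.suc m) * (s * order) + gain K (ℕ.suc m) * E⁺ ∎
      where
      open ≤-Reasoning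
      m = len L
      E⁺ = E r (L ▷ (l , p)) (⟦_⟧ ∘ good r (L ▷ (l , p)) gr⁺)

    good-exists : ∀ r L gr → loss K (len L) * (s * order) < sum deg → ∃[ x ] good r L gr x ≡ true
    good-exists r L gr dense with 0<E⇒∃ r L (0<p*q⇒0<q (<⇒≤ (0<gain 0<K (len L))) 0<rest)
      where
      B = gain K (len L) * E r L (⟦_⟧ ∘ good r L gr)
      A = loss K (len L) * (s * order)
      0<rest : 0ℚ < B
      0<rest with 0ℚ <? B
      ... | yes 0<B = 0<B
      ... | no  0≮B = contradiction (<-≤-trans dense (≤-trans (E-good r L gr)
              (subst (A + B ≤_) (+-identityʳ A) (+-monoʳ-≤ A (≮⇒≥ 0≮B))))) (<-irrefl refl)
    ... | x , 0<good = x , positive-indicator 0<good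

-- Counting in Γ

-- Checked on unnormalised fractions with denominator one, where no reduction to lowest terms
-- interferes.
ℕ→ℚ-+ : ∀ m n → ℕ→ℚ (m ℕ.+ n) ≡ ℕ→ℚ m + ℕ→ℚ n
ℕ→ℚ-+ m n = toℚᵘ-injective (begin
  ℚ.toℚᵘ (ℕ→ℚ (m ℕ.+ n))                     ≈⟨ toℚᵘ-fromℚᵘ (frac (m ℕ.+ n)) ⟩
  frac (m ℕ.+ n)                             ≈⟨ ℚᵘ.*≡* (cong (ℤ._* ℤ.+ 1) (cong₂ ℤ._+_ (i≡i*1 m) (i≡i*1 n))) ⟩
  frac m ℚᵘ.+ frac n                         ≈⟨ ℚᵘₚ.+-cong (toℚᵘ-fromℚᵘ (frac m)) (toℚᵘ-fromℚᵘ (frac n)) ⟨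
  ℚ.toℚᵘ (ℕ→ℚ m) ℚᵘ.+ ℚ.toℚᵘ (ℕ→ℚ n)         ≈⟨ toℚᵘ-homo-+ (ℕ→ℚ m) (ℕ→ℚ n) ⟨
  ℚ.toℚᵘ (ℕ→ℚ m + ℕ→ℚ n)                     ∎)
  where
  open ℚᵘₚ.≃-Reasoning
  i≡i*1 : ∀ m → ℤ.+ m ≡ ℤ.+ m ℤ.* ℤ.+ 1
  i≡i*1 m = sym (ℤₚ.*-identityʳ (ℤ.+ m))
  frac : ℕ → ℚᵘ.ℚᵘ
  frac m = ℚᵘ.mkℚᵘ (ℤ.+ m) 0

sum-1 : ∀ n → sum {n} (λ _ → 1ℚ) ≡ ℕ→ℚ n
sum-1 ℕ.zero    = sum-zero _
sum-1 (ℕ.suc n) = trans (sum-suc {n} _) (trans (cong (1ℚ +_) (sum-1 n)) (sym (ℕ→ℚ-+ 1 n)))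

module _ {a} {A : Set a} {P : Pred A a} (P? : Decidable P) where

  #filter : List A → ℚ
  #filter xs = ℕ→ℚ (List.length (filter P? xs))

  #filter-++ : ∀ xs ys → #filter (xs List.++ ys) ≡ #filter xs + #filter ys
  #filter-++ xs ys = trans
    (cong ℕ→ℚ (trans (cong List.length (filter-++ P? xs ys)) (length-++ (filter P? xs))))
    (ℕ→ℚ-+ (List.length (filter P? xs)) (List.length (filter P? ys)))

  #filter-∷ : ∀ x xs → #filter (x List.∷ xs) ≡ ⟦ does (P? x) ⟧ + #filter xs
  #filter-∷ x xs with does (P? x)
  ... | true  = ℕ→ℚ-+ 1 (List.length (filter P? xs))
  ... | false = sym (+-identityˡ _)

  #filter-tabulate : ∀ {n} (f : Fin n → A) → #filter (List.tabulate f) ≡ sum λ i → ⟦ does (P? (f i)) ⟧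
  #filter-tabulate {ℕ.zero}  f = sym (sum-zero _)
  #filter-tabulate {ℕ.suc n} f = trans (#filter-∷ (f zero) _)
    (trans (cong (⟦ does (P? (f zero)) ⟧ +_) (#filter-tabulate (f ∘ suc))) (sym (sum-suc _)))

-- Both `e` and `edgeCount` have this form, so both become double sums of indicators.
#filter-cartesianProduct : ∀ {A B : Set} {P : Pred (A × B) _} (P? : Decidable P)
  {m n} (f : Fin m → A) (h : Fin n → B) →
  #filter P? (cartesianProduct (List.tabulate f) (List.tabulate h)) ≡
  sum λ i → sum λ j → ⟦ does (P? (f i , h j)) ⟧
#filter-cartesianProduct P? {ℕ.zero}  f h = sym (sum-zero _)
#filter-cartesianProduct P? {ℕ.suc m} f h = begin
  #filter P? (List.map (f zero ,_) (List.tabulate h) List.++ rest)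
    ≡⟨ #filter-++ P? (List.map (f zero ,_) (List.tabulate h)) rest ⟩
  #filter P? (List.map (f zero ,_) (List.tabulate h)) + #filter P? rest
    ≡⟨ cong₂ _+_ (trans (cong (#filter P?) (map-tabulate h (f zero ,_))) (#filter-tabulate P? _))
                 (#filter-cartesianProduct P? (f ∘ suc) h) ⟩
  (sum λ j → ⟦ does (P? (f zero , h j)) ⟧) + (sum λ i → sum λ j → ⟦ does (P? (f (suc i) , h j)) ⟧)
    ≡⟨ sum-suc _ ⟨
  (sum λ i → sum λ j → ⟦ does (P? (f i , h j)) ⟧) ∎
  where
  open ≡-Reasoning
  rest = cartesianProduct (List.tabulate (f ∘ suc)) (List.tabulate h)

∣tabulate∣ : ∀ {n} (A : Fin n → Bool) → ℕ→ℚ ∣ Vec.tabulate A ∣ ≡ size A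
∣tabulate∣ {ℕ.zero}  A = sym (sum-zero _)
∣tabulate∣ {ℕ.suc n} A = trans (head (A zero))
  (trans (cong (⟦ A zero ⟧ +_) (∣tabulate∣ (A ∘ suc))) (sym (sum-suc _)))
  where
  tl = Vec.tabulate (A ∘ suc)
  head : ∀ b → ℕ→ℚ ∣ b Vec.∷ tl ∣ ≡ ⟦ b ⟧ + ℕ→ℚ ∣ tl ∣
  head true  = ℕ→ℚ-+ 1 ∣ tl ∣
  head false = sym (+-identityˡ _)

∈?-tabulate : ∀ {n} (A : Fin n → Bool) u → does (u ∈? Vec.tabulate A) ≡ A u
∈?-tabulate A zero with A zero
... | true  = refl
... | false = refl
∈?-tabulate A (suc u) = ∈?-tabulate (A ∘ suc) u

size-singleton : ∀ {n} (u : Fin n) → size (λ v → does (u ≟ v)) ≡ 1ℚ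
size-singleton {ℕ.suc n} zero    = trans (sum-suc _) (trans (cong (1ℚ +_) (sum-const-0 n)) (+-identityʳ 1ℚ))
size-singleton {ℕ.suc n} (suc u) = trans (sum-suc _) (trans (+-identityˡ _) (size-singleton u))

module _ {n} (Γ : Graph n) where

  open Graph Γ using (_~_; _~?_)

  pairs : (Fin n → Bool) → (Fin n → Bool) → ℚ
  pairs A B = sum λ u → sum λ v → ⟦ A u ∧ (B v ∧ does (u ~? v)) ⟧

  sparse-pairs : ∀ c t → Sparse c t Γ → ∀ A B → t ≤ size A → t ≤ size B →
                 pairs A B ≤ (1ℚ - c) * (size A * size B)
  sparse-pairs c t sparse A B t≤A t≤B = begin
    pairs A B
      ≡⟨ sum-cong (λ u → sum-cong λ v → cong ⟦_⟧ (cong₂ (λ a b → a ∧ (b ∧ does (u ~? v)))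
           (∈?-tabulate A u) (∈?-tabulate B v))) ⟨
    (sum λ u → sum λ v → ⟦ does (u ∈? A′) ∧ (does (v ∈? B′) ∧ does (u ~? v)) ⟧)
      ≡⟨ #filter-cartesianProduct _ (λ u → u) (λ v → v) ⟨
    ℕ→ℚ (e Γ A′ B′)
      ≤⟨ sparse A′ B′ (subst (t ≤_) (sym (∣tabulate∣ A)) t≤A) (subst (t ≤_) (sym (∣tabulate∣ B)) t≤B) ⟩
    (1ℚ - c) * (ℕ→ℚ ∣ A′ ∣ * ℕ→ℚ ∣ B′ ∣)
      ≡⟨ cong ((1ℚ - c) *_) (cong₂ _*_ (∣tabulate∣ A) (∣tabulate∣ B)) ⟩
    (1ℚ - c) * (size A * size B) ∎
    where
    open ≤-Reasoning
    A′ = Vec.tabulate A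
    B′ = Vec.tabulate B

  -- Otherwise sparsity applies to the singletons of the two endpoints and gives `1ℚ ≤ 1ℚ - c`.
  sparse-edge⇒1<t : ∀ {c t} → 0ℚ < c → Sparse c t Γ → ∀ {u v} → u ~ v → 1ℚ < t
  sparse-edge⇒1<t {c} {t} 0<c sparse {u} {v} u~v =
    decidable-stable (1ℚ <? t) λ 1≮t → <-irrefl refl (≤-<-trans (1≤1-c (≮⇒≥ 1≮t)) 1-c<1)
    where
    single : Fin n → Fin n → Bool
    single u v = does (u ≟ v)
    t≤single : t ≤ 1ℚ → ∀ u → t ≤ size (single u)
    t≤single t≤1 u = ≤-trans t≤1 (≤-reflexive (sym (size-singleton u)))
    edge-counted : 1ℚ ≤ pairs (single u) (single v)
    edge-counted = ≤-trans (≤-reflexive (sym (cong ⟦_⟧ here)))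
      (≤-trans (term≤sum (λ w → 0≤⟦⟧ (single u u ∧ (single v w ∧ does (u ~? w)))) v)
               (term≤sum (λ w → 0≤sum λ w′ → 0≤⟦⟧ (single u w ∧ (single v w′ ∧ does (w ~? w′)))) u))
      where
      here : single u u ∧ (single v v ∧ does (u ~? v)) ≡ true
      here = cong₂ _∧_ (dec-true (u ≟ u) refl) (cong₂ _∧_ (dec-true (v ≟ v) refl) (dec-true (u ~? v) u~v))
    1≤1-c : t ≤ 1ℚ → 1ℚ ≤ 1ℚ - c
    1≤1-c t≤1 = begin
      1ℚ
        ≤⟨ edge-counted ⟩
      pairs (single u) (single v)
        ≤⟨ sparse-pairs c t sparse (single u) (single v) (t≤single t≤1 u) (t≤single t≤1 v) ⟩
      (1ℚ - c) * (size (single u) * size (single v))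
        ≡⟨ cong ((1ℚ - c) *_) (cong₂ _*_ (size-singleton u) (size-singleton v)) ⟩
      (1ℚ - c) * (1ℚ * 1ℚ)
        ≡⟨ trans (cong ((1ℚ - c) *_) (*-identityʳ 1ℚ)) (*-identityʳ (1ℚ - c)) ⟩
      1ℚ - c ∎
      where open ≤-Reasoning
    1-c<1 : 1ℚ - c < 1ℚ
    1-c<1 = subst (1ℚ - c <_) (+-identityʳ 1ℚ) (+-monoʳ-< 1ℚ (neg-antimono-< 0<c))

  -- Equality is included so that copies avoiding blocked pairs are injective.
  blocked : Fin n → Fin n → Bool
  blocked u v = does (u ~? v) ∨ does (u ≟ v)

  size-split : ∀ A u → size A ≤ (sum λ v → ⟦ A v ∧ does (u ~? v) ⟧) + (size (remove blocked A u) + 1ℚ)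
  size-split A u = begin
    size A
      ≤⟨ sum-mono-≤ cover ⟩
    (sum λ v → near v + (⟦ remove blocked A u v ⟧ + ⟦ does (u ≟ v) ⟧))
      ≡⟨ trans (sum-distrib-+ near _) (cong (sum near +_) (sum-distrib-+ (⟦_⟧ ∘ remove blocked A u) _)) ⟩
    sum near + (size (remove blocked A u) + size (λ v → does (u ≟ v)))
      ≡⟨ cong (λ z → sum near + (size (remove blocked A u) + z)) (size-singleton u) ⟩
    sum near + (size (remove blocked A u) + 1ℚ) ∎
    where
    open ≤-Reasoning
    near = λ v → ⟦ A v ∧ does (u ~? v) ⟧
    cover : ∀ v → ⟦ A v ⟧ ≤ ⟦ A v ∧ does (u ~? v) ⟧ + (⟦ remove blocked A u v ⟧ + ⟦ does (u ≟ v) ⟧)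
    cover v with A v | does (u ~? v) | does (u ≟ v)
    ... | false | _     | b     = 0≤p+q ≤-refl (0≤p+q ≤-refl (0≤⟦⟧ b))
    ... | true  | true  | b     = p≤p+q (0≤p+q ≤-refl (0≤⟦⟧ b))
    ... | true  | false | true  = ≤-refl
    ... | true  | false | false = ≤-refl

  -- This is `size-split` multiplied by `K`. The indicator of badness makes it valid for every `u`,
  -- ready to be summed.
  bad-row : ∀ {K A} → 0ℚ < K → K ≤ size A → ∀ u →
            let bad = does (K * size (remove blocked A u) <? size A) in
            ⟦ bad ⟧ * (K * size A) ≤
            ⟦ bad ⟧ * (size A + size A) + K * sum λ v → ⟦ bad ∧ (A v ∧ does (u ~? v)) ⟧
  bad-row {K} {A} 0<K K≤A u with K * size (remove blocked A u) <? size A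
  ... | no  _ = begin
    0ℚ * (K * size A)                                   ≡⟨ *-zeroˡ (K * size A) ⟩
    0ℚ                                                  ≤⟨ 0≤p*q (<⇒≤ 0<K) (0≤sum {n} λ _ → ≤-refl) ⟩
    K * (sum {n} λ v → 0ℚ)                              ≡⟨ solve 2 (λ a k → k := con 0ℚ :* a :+ k) refl (size A + size A) _ ⟩
    0ℚ * (size A + size A) + K * (sum {n} λ v → 0ℚ)     ∎
    where open ≤-Reasoning
  ... | yes K*rem<A = begin
    1ℚ * (K * size A)
      ≤⟨ *-monoˡ-≤ 0≤1 (*-monoˡ-≤ (<⇒≤ 0<K) (size-split A u)) ⟩
    1ℚ * (K * (N + (R + 1ℚ)))
      ≡⟨ solve 3 (λ k n r → con 1ℚ :* (k :* (n :+ (r :+ con 1ℚ))) := k :* n :+ (k :* r :+ k)) refl K N R ⟩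
    K * N + (K * R + K)
      ≤⟨ +-monoʳ-≤ (K * N) (+-mono-≤ (<⇒≤ K*rem<A) K≤A) ⟩
    K * N + (size A + size A)
      ≡⟨ solve 2 (λ x a → x :+ a := con 1ℚ :* a :+ x) refl (K * N) (size A + size A) ⟩
    1ℚ * (size A + size A) + K * N ∎
    where
    open ≤-Reasoning
    N = sum λ v → ⟦ A v ∧ does (u ~? v) ⟧
    R = size (remove blocked A u)

  module _ {c t K : ℚ} (0<c : 0ℚ < c) (1≤t : 1ℚ ≤ t) (0<K : 0ℚ < K) (1≤K : 1ℚ ≤ K)
           (K*c : K * c ≡ c + (1ℚ + 1ℚ)) (sparse : Sparse c t Γ) where

    -- K times the non-neighbours of a bad u in A is at most |A| for the unblocked ones plus
    -- K ≤ |A| for u itself, whereas sparsity forces K * c * |A| = (c + 2) * |A| on average.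
    sparse⇒few-bad : ∀ A → K * t ≤ size A →
      size (λ u → does (K * size (remove blocked A u) <? size A)) ≤ K * t
    sparse⇒few-bad A Kt≤A = ≮⇒≥ λ Kt<B →
        -- Adding `0ℚ < c * X` to `many` gives a strict inequality between two sides that `balance`
        -- shows to be equal.
        <-irrefl balance (+-mono-≤-< (many Kt<B) (0<p*q 0<c (0<X Kt<B)))
      where
      0<t = <-≤-trans 0<1 1≤t
      B : Fin n → Bool
      B u = does (K * size (remove blocked A u) <? size A)
      t≤Kt : t ≤ K * t
      t≤Kt = subst (_≤ K * t) (*-identityˡ t) (*-monoʳ-≤ (<⇒≤ 0<t) 1≤K)
      X = size B * size A
      0<X : K * t < size B → 0ℚ < X
      0<X Kt<B = 0<p*q (<-trans (0<p*q 0<K 0<t) Kt<B) (<-≤-trans (0<p*q 0<K 0<t) Kt≤A)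
      K≤A : K ≤ size A
      K≤A = ≤-trans (subst (_≤ K * t) (*-identityʳ K) (*-monoˡ-≤ (<⇒≤ 0<K) 1≤t)) Kt≤A
      row : Fin n → ℚ
      row u = sum λ v → ⟦ B u ∧ (A v ∧ does (u ~? v)) ⟧
      sum-⟦B⟧* : ∀ z → (sum λ u → ⟦ B u ⟧ * z) ≡ size B * z
      sum-⟦B⟧* z = trans (sum-cong λ u → *-comm ⟦ B u ⟧ z) (trans (sym (*-distribˡ-sum z _)) (*-comm z (size B)))
      many : K * t < size B → size B * (K * size A) ≤ size B * (size A + size A) + K * ((1ℚ - c) * X)
      many Kt<B = begin
        size B * (K * size A)
          ≡⟨ sum-⟦B⟧* (K * size A) ⟨
        (sum λ u → ⟦ B u ⟧ * (K * size A))
          ≤⟨ sum-mono-≤ (bad-row 0<K K≤A) ⟩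
        (sum λ u → ⟦ B u ⟧ * (size A + size A) + K * row u)
          ≡⟨ trans (sum-distrib-+ _ (λ u → K * row u)) (cong₂ _+_ (sum-⟦B⟧* (size A + size A)) (sym (*-distribˡ-sum K row))) ⟩
        size B * (size A + size A) + K * pairs B A
          ≤⟨ +-monoʳ-≤ (size B * (size A + size A)) (*-monoˡ-≤ (<⇒≤ 0<K)
               (sparse-pairs c t sparse B A (≤-trans t≤Kt (<⇒≤ Kt<B)) (≤-trans t≤Kt Kt≤A))) ⟩
        size B * (size A + size A) + K * ((1ℚ - c) * X) ∎
        where open ≤-Reasoning
      balance : size B * (K * size A) + 0ℚ ≡ size B * (size A + size A) + K * ((1ℚ - c) * X) + c * X
      balance = begin
        size B * (K * size A) + 0ℚ
          ≡⟨ solve 4 (λ b a k c → b :* (k :* a) :+ con 0ℚ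
               := k :* (b :* a) :- k :* c :* (b :* a) :+ k :* c :* (b :* a)) refl (size B) (size A) K c ⟩
        K * X - K * c * X + K * c * X
          -- Only the added copy of `K * c` is evaluated; the subtracted one becomes part of
          -- `K * ((1ℚ - c) * X)`.
          ≡⟨ cong (λ z → K * X - K * c * X + z * X) K*c ⟩
        K * X - K * c * X + (c + (1ℚ + 1ℚ)) * X
          ≡⟨ solve 4 (λ b a k c → k :* (b :* a) :- k :* c :* (b :* a) :+ (c :+ (con 1ℚ :+ con 1ℚ)) :* (b :* a)
               := b :* (a :+ a) :+ k :* ((con 1ℚ :- c) :* (b :* a)) :+ c :* (b :* a)) refl (size B) (size A) K c ⟩
        size B * (size A + size A) + K * ((1ℚ - c) * X) + c * X ∎
        where open ≡-Reasoning

-- Growing the tree T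

visits? : ∀ {k} r (L : Steps (Fin k)) v → Dec (Visits r L v)
visits? r ε             v = v ≟ r
visits? r (L ▷ (l , p)) v = (v ≟ l) ⊎-dec visits? r L v

module _ {k} (T : Graph k) where

  open Graph T using (_~_; irrefl) renaming (sym to ~-sym)

  -- The predicate `P` confines the path, so that a vertex outside `P` can be added without losing
  -- injectivity.
  record Path (P : Fin k → Set) (u v : Fin k) : Set where
    field
      m         : ℕ
      vertex    : Fin (ℕ.suc m) → Fin k
      injective : Injective _≡_ _≡_ vertex
      step      : ∀ i → vertex (inject₁ i) ~ vertex (suc i)
      start     : vertex zero ≡ u
      end       : vertex (fromℕ m) ≡ v
      inside    : ∀ i → P (vertex i)

  trivial-path : ∀ {P : Fin k → Set} {v} → P v → Path P v v
  trivial-path {v = v} Pv = record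
    { m = 0 ; vertex = λ _ → v ; injective = λ { {zero} {zero} _ → refl } ; step = λ ()
    ; start = refl ; end = refl ; inside = λ _ → Pv }

  weaken-path : ∀ {P Q : Fin k → Set} {u v} → (∀ {w} → P w → Q w) → Path P u v → Path Q u v
  weaken-path P⊆Q π = record { Path π ; inside = P⊆Q ∘ Path.inside π }

  ∷-injective : ∀ {m} {a : Fin k} {f : Fin m → Fin k} → (∀ i → f i ≢ a) → Injective _≡_ _≡_ f →
                Injective _≡_ _≡_ (a Vector.∷ f)
  ∷-injective a∉ inj {zero}  {zero}  _  = refl
  ∷-injective a∉ inj {zero}  {suc j} eq = contradiction (sym eq) (a∉ j)
  ∷-injective a∉ inj {suc i} {zero}  eq = contradiction eq (a∉ i)
  ∷-injective a∉ inj {suc i} {suc j} eq = cong suc (inj eq)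

  cons-path : ∀ {P Q : Fin k → Set} {a b v} → a ~ b → Q a → ¬ P a → (∀ {w} → P w → Q w) →
              Path P b v → Path Q a v
  cons-path {P} {Q} {a} a~b Qa ¬Pa P⊆Q π = record
    { m         = ℕ.suc m
    ; vertex    = a Vector.∷ vertex
    ; injective = ∷-injective (λ i eq → ¬Pa (subst P eq (inside i))) injective
    ; step      = λ { zero → subst (a ~_) (sym start) a~b ; (suc i) → step i }
    ; start     = refl
    ; end       = end
    ; inside    = λ { zero → Qa ; (suc i) → P⊆Q (inside i) }
    }
    where open Path π

  path-to-root : ∀ q L → Grows q L → Edges _~_ L → ∀ {v} → Visits q L v → Path (Visits q L) v q
  path-to-root q ε _ _ refl = trivial-path refl
  path-to-root q (L ▷ (a , b)) (gr , a∉ , b∈) (eds , a~b) (inj₁ refl) =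
    cons-path a~b (inj₁ refl) a∉ inj₂ (path-to-root q L gr eds b∈)
  path-to-root q (L ▷ (a , b)) (gr , a∉ , b∈) (eds , a~b) (inj₂ v∈) =
    weaken-path inj₂ (path-to-root q L gr eds v∈)

  -- Distinct ends give the path at least two vertices, so with `a` the cycle has at least three.
  close-path : ∀ {P : Fin k → Set} {a u v} → ¬ P a → a ~ u → v ~ a → u ≢ v → Path P u v → Cycle T
  close-path ¬Pa a~u v~a u≢v record { m = ℕ.zero ; start = start ; end = end } =
    contradiction (trans (sym start) end) u≢v
  close-path {P} {a} ¬Pa a~u v~a u≢v record
    { m = ℕ.suc m ; vertex = f ; injective = inj ; step = step
    ; start = start ; end = end ; inside = inside } = record
    { m         = m
    ; vertex    = a Vector.∷ f
    ; injective = ∷-injective (λ i eq → ¬Pa (subst P eq (inside i))) inj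
    ; step      = λ { zero → subst (a ~_) (sym start) a~u ; (suc i) → step i }
    ; close     = subst (_~ a) (sym end) v~a
    }

  -- Together with `Edges` this says that the edges of `T` among visited vertices are exactly the
  -- parent edges.
  Spans : Fin k → Steps (Fin k) → Set
  Spans r ε             = ⊤
  Spans r (L ▷ (l , p)) = Spans r L × ∀ {v} → Visits r L v → l ~ v → v ≡ p

  record Growth (r : Fin k) : Set where
    field
      steps : Steps (Fin k)
      grows : Grows r steps
      edges : Edges _~_ steps
      spans : Spans r steps

  module _ (acyclic : ¬ Cycle T) {r : Fin k} where

    -- A second neighbour of `l` in the tree would be joined to `p` by a path avoiding `l`, found by
    -- rerooting at `p`, and `l` would close it to a cycle.
    attach : (G : Growth r) (let open Growth G) → ∀ {l p} → ¬ Visits r steps l → Visits r steps p →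
             l ~ p → Growth r
    attach G {l} {p} l∉ p∈ l~p = record
      { steps = steps ▷ (l , p)
      ; grows = grows , l∉ , p∈
      ; edges = edges , l~p
      ; spans = spans , only
      }
      where
      open Growth G
      module R = Rerooting (reroot r steps grows p∈)
      only : ∀ {v} → Visits r steps v → l ~ v → v ≡ p
      only {v} v∈ l~v with v ≟ p
      ... | yes v≡p = v≡p
      ... | no  v≢p = contradiction
        (close-path (l∉ ∘ R.visits⁻) l~v (~-sym l~p) v≢p
          (path-to-root p R.steps R.grows (R.edges ~-sym edges) (R.visits⁺ v∈))) acyclic

    _⊑_ : Growth r → Growth r → Set
    G ⊑ H = ∀ {v} → Visits r (Growth.steps G) v → Visits r (Growth.steps H) v

    -- Follows the walk and attaches each vertex that is still missing to its predecessor.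
    reach : ∀ G {u w} → Visits r (Growth.steps G) u → Star _~_ u w →
            Σ (Growth r) λ H → G ⊑ H × Visits r (Growth.steps H) w
    reach G u∈ Star.ε = G , (λ v∈ → v∈) , u∈
    reach G {u} u∈ (Star._◅_ {j = u′} u~u′ path) with visits? r (Growth.steps G) u′
    ... | yes u′∈ = reach G u′∈ path
    ... | no  u′∉ with reach (attach G u′∉ u∈ (~-sym u~u′)) (inj₁ refl) path
    ...   | H , G⊑H , w∈ = H , G⊑H ∘ inj₂ , w∈

    reach-all : (∀ v → Star _~_ r v) → ∀ {m} (f : Fin m → Fin k) →
                Σ (Growth r) λ G → ∀ i → Visits r (Growth.steps G) (f i)
    reach-all conn {ℕ.zero}  f = record { steps = ε ; grows = tt ; edges = tt ; spans = tt } , λ ()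
    reach-all conn {ℕ.suc m} f with reach-all conn (f ∘ suc)
    ... | G , covers with reach G (visits-root (Growth.steps G)) (conn (f zero))
    ...   | H , G⊑H , f₀∈ = H , λ { zero → f₀∈ ; (suc i) → G⊑H (covers i) }

    growth : (∀ v → Star _~_ r v) → Σ (Growth r) λ G → ∀ v → Visits r (Growth.steps G) v
    growth conn = reach-all conn (λ v → v)

-- Assembling the copy

does-true : ∀ {A : Set} (a? : Dec A) → does a? ≡ true → A
does-true (yes a) _ = a

does-false : ∀ {A : Set} (a? : Dec A) → does a? ≡ false → ¬ A
does-false (no ¬a) _ = ¬a

not-true : ∀ {b} → not b ≡ true → b ≡ false
not-true {false} _ = refl

∨-false : ∀ {a b} → a ∨ b ≡ false → a ≡ false × b ≡ false
∨-false {false} {false} _ = refl , refl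

module Soundness
  {n k} (T : Graph k)
  (g : Fin n → Fin n → Bool) (g-sym : ∀ u v → g u v ≡ g v u) (x₀ : Vec (Fin n) k)
  (M : Fin n → Fin n → Bool) (M-sym : ∀ u v → M u v ≡ M v u)
  {s K : ℚ} (0<s : 0ℚ < s) (1≤K : 1ℚ ≤ K)
  (few-bad : ∀ A → s ≤ size A → size (λ u → does (K * size (remove M A u) <? size A)) ≤ s)
  where

  open Graph T using (_~_; irrefl) renaming (sym to ~-sym)
  open Walk g g-sym x₀ using (X; deg; module Blocking)
  open Blocking M 0<s 1≤K few-bad

  cand⇒unblocked : ∀ q L {x w v} → Visits q L v → v ≢ q → cand q L x w ≡ true → M (lookup x v) w ≡ false
  cand⇒unblocked q ε v≡q v≢q _ = contradiction v≡q v≢q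
  cand⇒unblocked q (L ▷ (a , b)) {x} {w} (inj₁ refl) v≢q c =
    not-true (proj₂ (∧-true {cand q L x w} c))
  cand⇒unblocked q (L ▷ (a , b)) {x} {w} (inj₂ v∈) v≢q c =
    cand⇒unblocked q L v∈ v≢q (proj₁ (∧-true {cand q L x w} c))

  -- Puts the images into the vertex set of the subgraph: the root by its positive degree, every
  -- other vertex by the edge to its parent.
  good⇒neighbour : ∀ r L gr {x} → good r L gr x ≡ true → ∀ {v} → Visits r L v →
                   ∃[ w ] g (lookup x v) w ≡ true
  good⇒neighbour r ε _ {x} ok refl with 0<sum⇒∃ (does-true (0ℚ <? deg (lookup x r)) ok)
  ... | w , 0<g = w , positive-indicator 0<g
  good⇒neighbour r (L ▷ (l , p)) (gr , l∉ , p∈) {x} ok (inj₁ refl) =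
    lookup x p , trans (g-sym _ _) (cand⇒adjacent p (Rerooting.steps (reroot r L gr p∈))
                                      (proj₂ (∧-true {good r L gr x} ok)))
  good⇒neighbour r (L ▷ (l , p)) (gr , _) {x} ok (inj₂ v∈) =
    good⇒neighbour r L gr (proj₁ (∧-true {good r L gr x} ok)) v∈

  -- Symmetric in the pair, so each pair is checked only once, when the later of its two vertices is
  -- added.
  Matches : X → Fin k → Fin k → Set
  Matches x u v = (u ~ v × g (lookup x u) (lookup x v) ≡ true)
                ⊎ (¬ u ~ v × M (lookup x u) (lookup x v) ≡ false)

  matches-sym : ∀ {x u v} → Matches x u v → Matches x v u
  matches-sym (inj₁ (u~v , e)) = inj₁ (~-sym u~v , trans (g-sym _ _) e)
  matches-sym (inj₂ (u≁v , e)) = inj₂ (u≁v ∘ ~-sym , trans (M-sym _ _) e)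

  -- The image of a new vertex is a candidate at its parent: adjacent to the parent image and
  -- unblocked by all others, which by `Spans` are images of non-neighbours in `T`.
  good⇒matches : ∀ r L gr → Edges _~_ L → Spans T r L → ∀ {x} → good r L gr x ≡ true →
                 ∀ {u v} → Visits r L u → Visits r L v → u ≢ v → Matches x u v
  good⇒matches r ε _ _ _ _ refl refl u≢v = contradiction refl u≢v
  good⇒matches r (L ▷ (l , p)) (gr , l∉ , p∈) (eds , l~p) (spans , only) {x} ok = go
    where
    open Rerooting (reroot r L gr p∈)
    ok-L : good r L gr x ≡ true
    ok-L = proj₁ (∧-true ok)
    ok-l : cand p steps x (lookup x l) ≡ true
    ok-l = proj₂ (∧-true {good r L gr x} ok)
    old-new : ∀ {v} → Visits r L v → Matches x v l
    old-new {v} v∈ with v ≟ p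
    ... | yes refl = inj₁ (~-sym l~p , cand⇒adjacent p steps ok-l)
    ... | no  v≢p  = inj₂ (v≢p ∘ only v∈ ∘ ~-sym , cand⇒unblocked p steps (visits⁺ v∈) v≢p ok-l)
    go : ∀ {u v} → Visits r (L ▷ (l , p)) u → Visits r (L ▷ (l , p)) v → u ≢ v → Matches x u v
    go (inj₁ refl) (inj₁ refl) u≢v = contradiction refl u≢v
    go (inj₁ refl) (inj₂ v∈)   _   = matches-sym {x} (old-new v∈)
    go (inj₂ u∈)   (inj₁ refl) _   = old-new u∈
    go (inj₂ u∈)   (inj₂ v∈)   u≢v = good⇒matches r L gr eds spans ok-L u∈ v∈ u≢v

module _ {n} {Γ : Graph n} (G : Subgraph Γ) where

  module Γ = Graph Γ
  open Subgraph G using (verts; ~⇒∈; ~⇒Γ~) renaming (_~_ to _~ᴳ_; _~?_ to _~ᴳ?_; sym to ~ᴳ-sym)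

  adjacent : Fin n → Fin n → Bool
  adjacent u v = does (u ~ᴳ? v)

  adjacent-sym : ∀ u v → adjacent u v ≡ adjacent v u
  adjacent-sym u v = does-≡ (u ~ᴳ? v) (map′ ~ᴳ-sym ~ᴳ-sym (v ~ᴳ? u))

  blocked-sym : ∀ u v → blocked Γ u v ≡ blocked Γ v u
  blocked-sym u v = cong₂ _∨_ (does-≡ (u Γ.~? v) (map′ Γ.sym Γ.sym (v Γ.~? u)))
                              (does-≡ (u ≟ v) (map′ sym sym (v ≟ u)))

  pair-sum : ℚ
  pair-sum = sum λ u → sum λ v → ⟦ does (u Finₚ.<? v) ∧ adjacent u v ⟧

  edgeCount-sum : ℕ→ℚ (edgeCount G) ≡ pair-sum
  edgeCount-sum = #filter-cartesianProduct _ (λ u → u) (λ v → v)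

  edgeCount≤degrees : ℕ→ℚ (edgeCount G) ≤ sum λ v → size (adjacent v)
  edgeCount≤degrees = subst (_≤ sum (size ∘ adjacent)) (sym edgeCount-sum) (sum-mono-≤ λ u → sum-mono-≤ λ v →
    ⟦∧⟧≤ (does (u Finₚ.<? v)) (adjacent u v))
    where
    ⟦∧⟧≤ : ∀ a b → ⟦ a ∧ b ⟧ ≤ ⟦ b ⟧
    ⟦∧⟧≤ true  b = ≤-refl
    ⟦∧⟧≤ false b = 0≤⟦⟧ b

  edge-exists : 0ℚ < ℕ→ℚ (edgeCount G) → ∃[ u ] ∃[ v ] u ~ᴳ v
  edge-exists 0<e with 0<sum⇒∃ (subst (0ℚ <_) edgeCount-sum 0<e)
  ... | u , 0<row with 0<sum⇒∃ 0<row
  ...   | v , 0<uv = u , v , does-true (u ~ᴳ? v)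
          (proj₂ (∧-true {does (u Finₚ.<? v)} (positive-indicator 0<uv)))

  module _ {k} (T : Graph k) {r : Fin k} (H : Growth T r) (all∈ : ∀ v → Visits r (Growth.steps H) v)
           (x₀ : Fin n) {s K : ℚ} (0<s : 0ℚ < s) (1≤K : 1ℚ ≤ K)
           (few-bad : ∀ A → s ≤ size A →
              size (λ u → does (K * size (remove (blocked Γ) A u) <? size A)) ≤ s)
           where

    open Growth H
    open Walk adjacent adjacent-sym (Vec.replicate k x₀) using (X; deg; module Blocking)
    open Blocking (blocked Γ) 0<s 1≤K few-bad
    open Soundness T adjacent adjacent-sym (Vec.replicate k x₀) (blocked Γ) blocked-sym 0<s 1≤K few-bad

    good⇒copy : ∀ {x} → good r steps grows x ≡ true → ContainsInducedCopy T Γ G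
    good⇒copy {x} ok = record
      { embed     = lookup x
      ; injective = inj
      ; vertex    = λ v → let w , vw = good⇒neighbour r steps grows ok (all∈ v) in
                          ~⇒∈ (does-true (lookup x v ~ᴳ? w) vw)
      ; edge      = edge
      } , induced
      where
      matches : ∀ {u v} → u ≢ v → Matches x u v
      matches = good⇒matches r steps grows edges spans ok (all∈ _) (all∈ _)
      unblocked : ∀ {u v} → blocked Γ u v ≡ false → (¬ u Γ.~ v) × u ≢ v
      unblocked {u} {v} b = does-false (u Γ.~? v) (proj₁ (∨-false b))
                          , does-false (u ≟ v) (proj₂ (∨-false {does (u Γ.~? v)} b))
      inj : ∀ {u v} → lookup x u ≡ lookup x v → u ≡ v
      inj {u} {v} eq with u ≟ v
      ... | yes u≡v = u≡v
      ... | no  u≢v with matches u≢v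
      ...   | inj₁ (_ , g) = contradiction (~⇒Γ~ (does-true (_ ~ᴳ? _) g)) (Γ.irrefl eq)
      ...   | inj₂ (_ , b) = contradiction eq (proj₂ (unblocked b))
      edge : ∀ {u v} → Graph._~_ T u v → lookup x u ~ᴳ lookup x v
      edge {u} {v} u~v with matches {u} {v} (λ u≡v → Graph.irrefl T u≡v u~v)
      ... | inj₁ (_ , g)   = does-true (_ ~ᴳ? _) g
      ... | inj₂ (u≁v , _) = contradiction u~v u≁v
      induced : ∀ {u v} → lookup x u Γ.~ lookup x v → Graph._~_ T u v
      induced {u} {v} xu~xv with matches {u} {v} (λ u≡v → Γ.irrefl (cong (lookup x) u≡v) xu~xv)
      ... | inj₁ (u~v , _) = u~v
      ... | inj₂ (_ , b)   = contradiction xu~xv (proj₁ (unblocked b))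

    dense⇒copy : loss K (len steps) * (s * ℕ→ℚ n) < ℕ→ℚ (edgeCount G) → ContainsInducedCopy T Γ G
    dense⇒copy dense = good⇒copy (proj₂ (good-exists r steps grows
      (subst (λ N → loss K (len steps) * (s * N) < sum deg) (sym (sum-1 n))
             (<-≤-trans dense edgeCount≤degrees))))

-- Choice of the constants

module Constants {c : ℚ} (0<c : 0ℚ < c) where

  -- Chosen so that `K * c` exceeds two by `c`: in `sparse⇒few-bad` the two absorbs the
  -- `size A + size A` of each bad row, and `c` leaves the contradiction.
  K : ℚ
  K = 1ℚ + (1ℚ + 1ℚ) * recip c

  0≤2/c : 0ℚ ≤ (1ℚ + 1ℚ) * recip c
  0≤2/c = 0≤p*q (0≤p+q 0≤1 0≤1) (0≤recip c)

  1≤K : 1ℚ ≤ K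
  1≤K = p≤p+q 0≤2/c

  0<K : 0ℚ < K
  0<K = <-≤-trans 0<1 1≤K

  K*c : K * c ≡ c + (1ℚ + 1ℚ)
  K*c = trans (solve 2 (λ c r → (con 1ℚ :+ (con 1ℚ :+ con 1ℚ) :* r) :* c
                          := c :+ (con 1ℚ :+ con 1ℚ) :* (c :* r)) refl c (recip c))
              (cong (λ z → c + (1ℚ + 1ℚ) * z) (*-recip 0<c))

  -- The factor `K` comes from taking `s = K * t`. The added two makes the constant exceed one and
  -- the comparison with the loss strict.
  threshold : ℕ → ℚ
  threshold m = loss K m * K + (1ℚ + 1ℚ)

  1<threshold : ∀ m → 1ℚ < threshold m
  1<threshold m = <-≤-trans (+-monoʳ-< 1ℚ 0<1) (q≤p+q (0≤p*q (0≤loss 0<K m) (<⇒≤ 0<K)))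

  threshold-beats-loss : ∀ m {t N} → 0ℚ < t → 0ℚ < N → loss K m * (K * t * N) < threshold m * t * N
  threshold-beats-loss m {t} {N} 0<t 0<N = begin-strict
    loss K m * (K * t * N)
      ≡⟨ +-identityʳ _ ⟨
    loss K m * (K * t * N) + 0ℚ
      <⟨ +-monoʳ-< (loss K m * (K * t * N)) (0<p*q (0<p*q (positive⁻¹ (1ℚ + 1ℚ)) 0<t) 0<N) ⟩
    loss K m * (K * t * N) + (1ℚ + 1ℚ) * t * N
      ≡⟨ solve 4 (λ l k t n → l :* (k :* t :* n) :+ (con 1ℚ :+ con 1ℚ) :* t :* n
             := (l :* k :+ (con 1ℚ :+ con 1ℚ)) :* t :* n) refl (loss K m) K t N ⟩
    threshold m * t * N ∎
    where open ≤-Reasoning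

0<ℕ→ℚ : ∀ n → NonZero n → 0ℚ < ℕ→ℚ n
0<ℕ→ℚ (ℕ.suc n) _ = <-≤-trans 0<1 (subst (1ℚ ≤_) (sum-1 (ℕ.suc n)) (term≤sum {ℕ.suc n} (λ _ → 0≤1) zero))

theorem1p7 : (k : ℕ) (T : Graph k) → IsTree T → (c : ℚ) → 0ℚ < c →
    ∃[ C ] (1ℚ < C ×
    ((n : ℕ) → NonZero n → (Γ : Graph n) (t : ℚ) → 0ℚ < t → Sparse c t Γ →
    (G : Subgraph Γ) → C * t * ℕ→ℚ n ≤ ℕ→ℚ (edgeCount G) →
    ContainsInducedCopy T Γ G))
theorem1p7 (ℕ.suc k) T ((_ , connected) , acyclic) c 0<c = C , 1<threshold m , copy
  where
  open Constants 0<c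
  H  = growth T acyclic (connected zero)
  m  = len (Growth.steps (proj₁ H))
  C  = threshold m
  copy : ∀ n → NonZero n → (Γ : Graph n) (t : ℚ) → 0ℚ < t → Sparse c t Γ →
         (G : Subgraph Γ) → C * t * ℕ→ℚ n ≤ ℕ→ℚ (edgeCount G) → ContainsInducedCopy T Γ G
  copy n n≢0 Γ t 0<t sparse G dense =
    -- An edge of `G` exists because the edge count is positive. Its first endpoint serves as the
    -- default image, and its presence in `Γ` forces `1ℚ < t`.
    dense⇒copy G T (proj₁ H) (proj₂ H) (proj₁ edge) (0<p*q 0<K 0<t) 1≤K
      (sparse⇒few-bad Γ 0<c (<⇒≤ 1<t) 0<K 1≤K K*c sparse)
      (<-≤-trans (threshold-beats-loss m 0<t 0<N) dense)
    where
    0<N = 0<ℕ→ℚ n n≢0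
    edge = edge-exists G (<-≤-trans (0<p*q (0<p*q (<-trans 0<1 (1<threshold m)) 0<t) 0<N) dense)
    1<t : 1ℚ < t
    1<t = sparse-edge⇒1<t Γ 0<c sparse (Subgraph.~⇒Γ~ G (proj₂ (proj₂ edge)))
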